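{- Let $A\in\mathbb{R}^{n\times n}$, let $i\in\{1,\dots,n\}$ with $A_{ii}\ne0$, let $\bar\varepsilon>0$ and $\delta\in(0,1)$, and let $s$ be a positive integer with $$s > 2\left(\frac{\|\bm{A}_i\|_2^2-A_{ii}^2}{A_{ii}^2}\right)\frac{\ln(2/\delta)}{\bar\varepsilon^2},$$ where $\bm{A}_i$ is the $i$-th row of $A$ regarded as a vector. Let $R_i^s$ be the $i$-th component of the Rademacher diagonal estimator of $A$ with $s$ queries. Then $$\Pr\big(|R_i^s-A_{ii}|\le\bar\varepsilon|A_{ii}|\big)\ge 1-\delta.$$
   Context: The Rademacher diagonal estimator of $A\in\mathbb{R}^{n\times n}$ with $s$ queries is the random vector $\bm{R}^s=\frac1s\sum_{k=1}^s \bm{v}_k\odot A\bm{v}_k\in\mathbb{R}^n$, where $\bm{v}_1,\dots,\bm{v}_s$ are independent random vectors in $\mathbb{R}^n$ whose entries are i.i.d. Rademacher variables (values $\pm1$ with probability $1/2$ each), and $\odot$ denotes component-wise multiplication. $\|\cdot\|_2$ is the Euclidean norm. -}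

module Defs where

open import Algebra.Apartness.Bundles using (HeytingCommutativeRing; HeytingField)
import Algebra.Apartness.Properties.HeytingCommutativeRing as HeytingProperties
open import Algebra.Bundles using (CommutativeRing; Semiring)
import Algebra.Definitions.RawSemiring as RawSemiringDefinitions
open import Data.Bool.Base using (Bool; T)
open import Data.Fin.Base using (Fin; toℕ)
open import Data.List.Base using (List; []; _∷_; length; filterᵇ; cartesianProductWith)
open import Data.Nat.Base as ℕ using (ℕ; zero; suc; NonZero; _!)
open import Data.Nat.Properties using (m^n≢0; _!≢0)
open import Data.Product.Base using (_×_; _,_; ∃; proj₁)
open import Data.Sign.Base using (Sign)
open import Data.Sum.Base using (_⊎_; inj₁; inj₂)
open import Data.Vec.Base as Vec using (Vec; lookup)
open import Data.Vec.Functional using (Vector; zipWith)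
open import Function.Base using (_∘_)
open import Function.Bundles using (_⇔_; Equivalence)
open import Level using (Level) renaming (_⊔_ to _⊔ˡ_; suc to lsuc)
open import Relation.Binary.Core using (Rel)
open import Relation.Binary.Lattice.Definitions using (Supremum)
open import Relation.Binary.Structures using (IsStrictPartialOrder)
open import Relation.Nullary.Negation using (¬_)

-- The real numbers, presented as a Cauchy-complete Archimedean ordered field.
-- Classically these axioms determine ℝ up to unique isomorphism; they are
-- worded so that constructive reals satisfy them as well (the order is not
-- assumed decidable, and x ≠ 0 is read as the apartness x # 0#).
record RealNumbers c ℓ₁ ℓ₂ : Set (lsuc (c ⊔ˡ ℓ₁ ⊔ˡ ℓ₂)) where
  field
    heytingField : HeytingField c ℓ₁ ℓ₂

  open HeytingField heytingField public

  commutativeRing : CommutativeRing c ℓ₁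
  commutativeRing = HeytingCommutativeRing.commutativeRing heytingCommutativeRing

  open RawSemiringDefinitions
    (Semiring.rawSemiring (CommutativeRing.semiring commutativeRing)) public
    using (_^_; sum) renaming (_×_ to _times_)

  infix  4 _<_ _≤_
  infixl 6 _⊔_

  field
    _<_                    : Rel Carrier ℓ₂
    <-isStrictPartialOrder : IsStrictPartialOrder _≈_ _<_
    #⇔<⊎>                  : ∀ {x y} → x # y ⇔ (x < y ⊎ y < x)
    0<1                    : 0# < 1#
    +-monoʳ-<              : ∀ z {x y} → x < y → z + x < z + y
    *-pos                  : ∀ {x y} → 0# < x → 0# < y → 0# < x * y

  _≤_ : Rel Carrier ℓ₂
  x ≤ y = ¬ (y < x)

  field
    _⊔_        : Carrier → Carrier → Carrier
    ⊔-supremum : Supremum _≤_ _⊔_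

  ∣_∣ : Carrier → Carrier
  ∣ x ∣ = x ⊔ (- x)

  fromℕ : ℕ → Carrier
  fromℕ n = n times 1#

  IsCauchy : (ℕ → Carrier) → Set (c ⊔ˡ ℓ₂)
  IsCauchy u = ∀ ε → 0# < ε →
    ∃ λ N → ∀ m n → N ℕ.≤ m → N ℕ.≤ n → ∣ u m - u n ∣ < ε

  infix 4 _⟶_
  _⟶_ : (ℕ → Carrier) → Carrier → Set (c ⊔ˡ ℓ₂)
  u ⟶ l = ∀ ε → 0# < ε → ∃ λ N → ∀ n → N ℕ.≤ n → ∣ u n - l ∣ < ε

  field
    archimedean : ∀ x → ∃ λ n → x < fromℕ n
    complete    : ∀ u → IsCauchy u → ∃ λ l → u ⟶ l

  open HeytingProperties heytingCommutativeRing public using (x#0y#0→xy#0)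
  open IsStrictPartialOrder <-isStrictPartialOrder public
    using (<-respʳ-≈) renaming (trans to <-trans)

  pos⇒#0 : ∀ {x} → 0# < x → x # 0#
  pos⇒#0 0<x = Equivalence.from #⇔<⊎> (inj₂ 0<x)

  fromℕ-pos : ∀ n .{{_ : NonZero n}} → 0# < fromℕ n
  fromℕ-pos (suc zero)    = <-respʳ-≈ (sym (+-identityʳ 1#)) 0<1
  fromℕ-pos (suc (suc n)) =
    <-trans (fromℕ-pos 1) (+-monoʳ-< 1# (fromℕ-pos (suc n)))

  fromℕ#0 : ∀ n .{{_ : NonZero n}} → fromℕ n # 0#
  fromℕ#0 n = pos⇒#0 (fromℕ-pos n)

  -- #⇒invertible provides the inverse of y - 0#.
  infixl 7 _/_[_]
  _/_[_] : (x y : Carrier) → y # 0# → Carrier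
  x / y [ y#0 ] = x * proj₁ (#⇒invertible y#0)

  infix 9 _²
  _² : Carrier → Carrier
  x ² = x * x

  ²#0 : ∀ {x} → x # 0# → x ² # 0#
  ²#0 x#0 = x#0y#0→xy#0 x#0 x#0

  expSum : Carrier → ℕ → Carrier
  expSum x N = sum {N} λ k →
    x ^ toℕ k / fromℕ (toℕ k !) [ fromℕ#0 (toℕ k !) {{toℕ k !≢0}} ]

  -- IsExp x y says y = exp x = Σ xᵏ/k!; IsLn y l says l = ln y, the inverse
  -- function given by its graph.
  IsExp : Carrier → Carrier → Set (c ⊔ˡ ℓ₂)
  IsExp x y = expSum x ⟶ y

  IsLn : Carrier → Carrier → Set (c ⊔ˡ ℓ₂)
  IsLn y l = IsExp l y


module DiagonalEstimation {c ℓ₁ ℓ₂} (ℝ : RealNumbers c ℓ₁ ℓ₂) where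
  open RealNumbers ℝ

  Matrix : ℕ → Set c
  Matrix n = Vector (Vector Carrier n) n

  infixr 7 _·ᵥ_ _⊙_

  _·ᵥ_ : ∀ {n} → Matrix n → Vector Carrier n → Vector Carrier n
  (A ·ᵥ x) i = sum λ j → A i j * x j

  _⊙_ : ∀ {n} → Vector Carrier n → Vector Carrier n → Vector Carrier n
  _⊙_ = zipWith _*_

  -- The squared Euclidean norm.
  ∥_∥₂² : ∀ {n} → Vector Carrier n → Carrier
  ∥ x ∥₂² = sum λ j → (x j) ²

  -- Ω s n is the sample space {±1}ⁿˣˢ of s vectors with n Rademacher entries
  -- each. Entries being independent and fair, all outcomes are equally likely.
  Ω : ℕ → ℕ → Set
  Ω s n = Vec (Vec Sign n) s

  vectorsOver : ∀ {a} {X : Set a} → List X → (m : ℕ) → List (Vec X m)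
  vectorsOver xs zero    = Vec.[] ∷ []
  vectorsOver xs (suc m) = cartesianProductWith Vec._∷_ xs (vectorsOver xs m)

  outcomes : ∀ s n → List (Ω s n)
  outcomes s n = vectorsOver (vectorsOver (Sign.+ ∷ Sign.- ∷ []) n) s

  Pr : ∀ {s n} → (Ω s n → Bool) → Carrier
  Pr {s} {n} D =
    fromℕ (length (filterᵇ D (outcomes s n)))
      / fromℕ (2 ℕ.^ (s ℕ.* n)) [ fromℕ#0 (2 ℕ.^ (s ℕ.* n)) {{m^n≢0 2 (s ℕ.* n)}} ]

  -- Since the order on ℝ need not be decidable, "Pr(E) ≥ p" says that E
  -- contains a decidable event of probability at least p; for decidable E
  -- this is the usual inequality, by monotonicity of Pr.
  infix 4 Pr[_]≥_
  Pr[_]≥_ : ∀ {s n ℓ} → (Ω s n → Set ℓ) → Carrier → Set (ℓ₂ ⊔ˡ ℓ)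
  Pr[_]≥_ {s} {n} E p = ∃ λ (D : Ω s n → Bool) → (∀ ω → T (D ω) → E ω) × p ≤ Pr D

  ⟦_⟧ : Sign → Carrier
  ⟦ Sign.+ ⟧ = 1#
  ⟦ Sign.- ⟧ = - 1#

  query : ∀ {s n} → Ω s n → Fin s → Vector Carrier n
  query ω k i = ⟦ lookup (lookup ω k) i ⟧

  rademacherEstimator : ∀ {s n} .{{_ : NonZero s}} → Matrix n → Ω s n → Vector Carrier n
  rademacherEstimator {s} A ω i =
    sum (λ k → (query ω k ⊙ (A ·ᵥ query ω k)) i) / fromℕ s [ fromℕ#0 s ]

-- Chernoff's method with truncated exponentials. Let b be the i-th row of A
-- without its diagonal entry, S = s (Rᵢ - Aᵢᵢ) = Σₖ Σⱼ bⱼ vₖᵢ vₖⱼ, v = ‖b‖²,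
-- η = ε̄ |Aᵢᵢ| and L = ln(2/δ). With r = L/(sη) the hypothesis on s makes
-- Pr(S ≥ sη) exp(2rS) ≤ E exp(2rS) ≤ exp(2r²sv) yield Pr(S ≥ sη) ≤ exp(-L) = δ/2,
-- and no division by v is needed.
--
-- No exponential function has to be constructed: exp(2rS) is replaced by
-- Π (1 + (r/m) bⱼ vₖᵢ vₖⱼ)^2m, which is at least (1 + 2rS/m - O(1/m²))^m, and whose
-- expectation is at most (1 - 2r²sv/m)^-m. Since the partial sums of exp L are at
-- most (1 - L/m)^-m, letting first m and then the number of terms tend to infinity
-- gives the bound.

module Submission where

open import Algebra.Bundles using (CommutativeRing; RawRing; Semiring)
import Algebra.Definitions.RawSemiring as RawSemiringDefinitions
import Algebra.Properties.CommutativeSemiring.Exp as ExpProperties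
import Algebra.Properties.Ring as RingProperties
import Algebra.Properties.Semiring.Mult as MultProperties
import Algebra.Properties.Semiring.Sum as SumProperties
import Algebra.Solver.Ring as RingSolver
open import Algebra.Solver.Ring.AlmostCommutativeRing using (AlmostCommutativeRing; fromCommutativeRing; _-Raw-AlmostCommutative⟶_)
open import Data.Bool.Base using (Bool; true; false; T; _∧_)
open import Data.Empty using (⊥-elim)
open import Data.Fin.Base using (Fin; zero; suc; toℕ)
open import Data.Integer.Base as ℤ using (ℤ; +_; -[1+_]; _⊖_)
import Data.Integer.Properties as ℤ
open import Data.List.Base using (List; []; _∷_; _++_; map; length; filterᵇ; cartesianProductWith)
open import Data.Maybe.Base using (Maybe; just; nothing)
open import Data.Nat.Base as ℕ using (ℕ; zero; suc; NonZero; _!)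
import Data.Nat.Properties as ℕ
open import Data.Nat.Tactic.RingSolver using (solve-∀)
open import Data.Product.Base using (_×_; _,_; ∃; proj₁; proj₂)
open import Data.Sign.Base using (Sign)
open import Data.Sum.Base using (_⊎_; inj₁; inj₂; [_,_]′)
open import Data.Vec.Base using (Vec; []; _∷_; lookup)
open import Data.Vec.Functional using (Vector; updateAt)
open import Defs
open import Function.Base using (_∘_; const)
open import Function.Bundles using (Equivalence)
open import Level using (Level)
open import Relation.Binary.PropositionalEquality.Core as ≡ using (_≡_)
open import Relation.Binary.Structures using (IsPreorder; IsStrictPartialOrder)
import Relation.Binary.Reasoning.Base.Triple as TripleReasoning
open import Relation.Nullary.Decidable.Core using (yes; no)
open import Relation.Nullary.Negation using (¬_)

-- Two obstacles shape the details. First, the order is undecidable, so no Boolean test can single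
-- out the outcomes with |S| ≤ sη. The strictness of the hypothesis helps: writing it as Q < s, the
-- tail bound already holds for S > η(s + Q)/2, because rη(s + Q) equals L + 2r²sv exactly. Between
-- η(s + Q)/2 and ηs there is a gap, and cotransitivity of < can decide on which side of the gap S
-- falls. Second, ln(2/δ) is only known as a number L at which the exponential series converges to
-- 2/δ. That L ≥ 0, on which the tail estimates rest, has to be extracted from the series: for
-- negative L its partial sums of even length would stay at most 1. The even exponent 2m has its
-- origin in cosh x ≤ exp(x²/2): with N = 2m factors the exponent N²/2 is the natural number 2m · m.

-- A ring solver with integer coefficients.

module IntegerRingSolver {c ℓ} (R : CommutativeRing c ℓ) where
  open CommutativeRing R
  open RingProperties ring
  open import Relation.Binary.Reasoning.Setoid setoid

  -- 0 and 1 are mapped to 0# and 1# on the nose, so that these constants can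
  -- occur in goals of the solver.
  natural : ℕ → Carrier
  natural zero          = 0#
  natural (suc zero)    = 1#
  natural (suc (suc n)) = 1# + natural (suc n)

  integer : ℤ → Carrier
  integer (+ n)    = natural n
  integer -[1+ n ] = - natural (suc n)

  natural-suc : ∀ n → natural (suc n) ≈ 1# + natural n
  natural-suc zero    = sym (+-identityʳ 1#)
  natural-suc (suc n) = refl

  natural-+ : ∀ m n → natural (m ℕ.+ n) ≈ natural m + natural n
  natural-+ zero    n = sym (+-identityˡ _)
  natural-+ (suc m) n = begin
    natural (suc (m ℕ.+ n))        ≈⟨ natural-suc (m ℕ.+ n) ⟩
    1# + natural (m ℕ.+ n)         ≈⟨ +-congˡ (natural-+ m n) ⟩
    1# + (natural m + natural n)   ≈⟨ +-assoc _ _ _ ⟨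
    1# + natural m + natural n     ≈⟨ +-congʳ (natural-suc m) ⟨
    natural (suc m) + natural n    ∎

  natural-* : ∀ m n → natural (m ℕ.* n) ≈ natural m * natural n
  natural-* zero    n = sym (zeroˡ _)
  natural-* (suc m) n = begin
    natural (n ℕ.+ m ℕ.* n)                  ≈⟨ natural-+ n (m ℕ.* n) ⟩
    natural n + natural (m ℕ.* n)            ≈⟨ +-cong (sym (*-identityˡ _)) (natural-* m n) ⟩
    1# * natural n + natural m * natural n   ≈⟨ distribʳ _ _ _ ⟨
    (1# + natural m) * natural n             ≈⟨ *-congʳ (natural-suc m) ⟨
    natural (suc m) * natural n              ∎

  cancel-1# : ∀ x y → (1# + x) - (1# + y) ≈ x - y
  cancel-1# x y = begin
    (1# + x) - (1# + y)        ≈⟨ +-congˡ (-‿+-comm 1# y) ⟨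
    (1# + x) + (- 1# + - y)    ≈⟨ +-congʳ (+-comm 1# x) ⟩
    (x + 1#) + (- 1# + - y)    ≈⟨ +-assoc _ _ _ ⟩
    x + (1# + (- 1# + - y))    ≈⟨ +-congˡ (+-assoc _ _ _) ⟨
    x + ((1# + - 1#) + - y)    ≈⟨ +-congˡ (+-congʳ (-‿inverseʳ 1#)) ⟩
    x + (0# + - y)             ≈⟨ +-congˡ (+-identityˡ _) ⟩
    x - y                      ∎

  integer-⊖ : ∀ m n → integer (m ⊖ n) ≈ natural m - natural n
  integer-⊖ m zero = begin
    integer (m ⊖ 0)    ≡⟨ ≡.cong integer (ℤ.⊖-≥ {m} ℕ.z≤n) ⟩
    natural m          ≈⟨ +-identityʳ _ ⟨
    natural m + 0#     ≈⟨ +-congˡ -0#≈0# ⟨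
    natural m - 0#     ∎
  integer-⊖ zero    (suc n) = sym (+-identityˡ _)
  integer-⊖ (suc m) (suc n) = begin
    integer (suc m ⊖ suc n)                  ≡⟨ ≡.cong integer (ℤ.[1+m]⊖[1+n]≡m⊖n m n) ⟩
    integer (m ⊖ n)                          ≈⟨ integer-⊖ m n ⟩
    natural m - natural n                    ≈⟨ cancel-1# _ _ ⟨
    (1# + natural m) - (1# + natural n)      ≈⟨ +-cong (natural-suc m) (-‿cong (natural-suc n)) ⟨
    natural (suc m) - natural (suc n)        ∎

  integer-neg : ∀ i → integer (ℤ.- i) ≈ - integer i
  integer-neg (+ zero)  = sym -0#≈0#
  integer-neg (+ suc n) = refl
  integer-neg -[1+ n ]  = sym (-‿involutive _)

  integer-+ : ∀ i j → integer (i ℤ.+ j) ≈ integer i + integer j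
  integer-+ (+ m)    (+ n)    = natural-+ m n
  integer-+ (+ m)    -[1+ n ] = integer-⊖ m (suc n)
  integer-+ -[1+ m ] (+ n)    = trans (integer-⊖ n (suc m)) (+-comm _ _)
  integer-+ -[1+ m ] -[1+ n ] = begin
    - (1# + natural (suc (m ℕ.+ n)))         ≈⟨ -‿cong (natural-suc (suc (m ℕ.+ n))) ⟨
    - natural (suc (suc (m ℕ.+ n)))          ≡⟨ ≡.cong (λ k → - natural (suc k)) (ℕ.+-suc m n) ⟨
    - natural (suc m ℕ.+ suc n)              ≈⟨ -‿cong (natural-+ (suc m) (suc n)) ⟩
    - (natural (suc m) + natural (suc n))    ≈⟨ -‿+-comm _ _ ⟨
    - natural (suc m) + - natural (suc n)    ∎

  integer-*-pos : ∀ m n → integer (+ m ℤ.* + n) ≈ natural m * natural n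
  integer-*-pos m n = begin
    integer (+ m ℤ.* + n)     ≡⟨ ≡.cong integer (ℤ.pos-* m n) ⟨
    natural (m ℕ.* n)         ≈⟨ natural-* m n ⟩
    natural m * natural n     ∎

  integer-*ˡ-pos : ∀ m j → integer (+ m ℤ.* j) ≈ natural m * integer j
  integer-*ˡ-pos m (+ n)    = integer-*-pos m n
  integer-*ˡ-pos m -[1+ n ] = begin
    integer (+ m ℤ.* -[1+ n ])         ≡⟨ ≡.cong integer (ℤ.neg-distribʳ-* (+ m) (+ suc n)) ⟨
    integer (ℤ.- (+ m ℤ.* + suc n))    ≈⟨ integer-neg (+ m ℤ.* + suc n) ⟩
    - integer (+ m ℤ.* + suc n)        ≈⟨ -‿cong (integer-*-pos m (suc n)) ⟩
    - (natural m * natural (suc n))    ≈⟨ -‿distribʳ-* _ _ ⟩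
    natural m * - natural (suc n)      ∎

  integer-* : ∀ i j → integer (i ℤ.* j) ≈ integer i * integer j
  integer-* (+ m)    j = integer-*ˡ-pos m j
  integer-* -[1+ m ] j = begin
    integer (-[1+ m ] ℤ.* j)           ≡⟨ ≡.cong integer (ℤ.neg-distribˡ-* (+ suc m) j) ⟨
    integer (ℤ.- (+ suc m ℤ.* j))      ≈⟨ integer-neg (+ suc m ℤ.* j) ⟩
    - integer (+ suc m ℤ.* j)          ≈⟨ -‿cong (integer-*ˡ-pos (suc m) j) ⟩
    - (natural (suc m) * integer j)    ≈⟨ -‿distribˡ-* _ _ ⟩
    - natural (suc m) * integer j      ∎

  almostCommutativeRing : AlmostCommutativeRing c ℓ
  almostCommutativeRing = fromCommutativeRing R

  ℤ-rawRing : RawRing _ _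
  ℤ-rawRing = CommutativeRing.rawRing ℤ.+-*-commutativeRing

  integerMorphism : ℤ-rawRing -Raw-AlmostCommutative⟶ almostCommutativeRing
  integerMorphism = record
    { ⟦_⟧    = integer
    ; +-homo = integer-+
    ; *-homo = integer-*
    ; -‿homo = integer-neg
    ; 0-homo = refl
    ; 1-homo = refl
    }

  integer≟ : ∀ i j → Maybe (integer i ≈ integer j)
  integer≟ i j with i ℤ.≟ j
  ... | yes ≡.refl = just refl
  ... | no  _      = nothing

  open RingSolver ℤ-rawRing almostCommutativeRing integerMorphism integer≟ public
    using (solve; con; _:+_; _:*_; _:-_; :-_; _:=_; Polynomial)

-- Arithmetic of the undecidable order.

module OrderedField {c ℓ₁ ℓ₂} (ℝ : RealNumbers c ℓ₁ ℓ₂) where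
  open RealNumbers ℝ hiding (zero)
  open IntegerRingSolver commutativeRing public
    using (solve; con; _:+_; _:*_; _:-_; :-_; _:=_; Polynomial)
  open RingProperties (CommutativeRing.ring commutativeRing) public using (-0#≈0#; -‿involutive; -‿distribˡ-*)

  :0 :1 :2 : ∀ {n} → Polynomial n
  :0 = con (+ 0)
  :1 = con (+ 1)
  :2 = :1 :+ (:1 :+ :0)

  private variable
    d x y z w : Carrier

  <-irrefl : ¬ x < x
  <-irrefl = IsStrictPartialOrder.irrefl <-isStrictPartialOrder refl

  <-asym : x < y → ¬ y < x
  <-asym = IsStrictPartialOrder.asym <-isStrictPartialOrder

  <-respˡ-≈ : x ≈ y → x < z → y < z
  <-respˡ-≈ = IsStrictPartialOrder.<-respˡ-≈ <-isStrictPartialOrder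

  -- The constructive substitute for trichotomy. It comes from cotransitivity of apartness; where
  -- apartness points the wrong way, transitivity through x < y repairs it.
  <-cotrans : x < y → ∀ z → x < z ⊎ z < y
  <-cotrans {x} {y} x<y z with #-cotrans (Equivalence.from #⇔<⊎> (inj₁ x<y)) z
  ... | inj₁ x#z with Equivalence.to #⇔<⊎> x#z
  ...   | inj₁ x<z = inj₁ x<z
  ...   | inj₂ z<x = inj₂ (<-trans z<x x<y)
  <-cotrans {x} {y} x<y z | inj₂ z#y with Equivalence.to #⇔<⊎> z#y
  ...   | inj₁ z<y = inj₂ z<y
  ...   | inj₂ y<z = inj₁ (<-trans x<y y<z)

  <⇒≤ : x < y → x ≤ y
  <⇒≤ = <-asym

  ≤-reflexive : x ≈ y → x ≤ y
  ≤-reflexive x≈y = IsStrictPartialOrder.irrefl <-isStrictPartialOrder (sym x≈y)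

  ≤-refl : x ≤ x
  ≤-refl = <-irrefl

  <-≤-trans : x < y → y ≤ z → x < z
  <-≤-trans {z = z} x<y y≤z with <-cotrans x<y z
  ... | inj₁ x<z = x<z
  ... | inj₂ z<y = ⊥-elim (y≤z z<y)

  ≤-<-trans : x ≤ y → y < z → x < z
  ≤-<-trans {x = x} x≤y y<z with <-cotrans y<z x
  ... | inj₁ y<x = ⊥-elim (x≤y y<x)
  ... | inj₂ x<z = x<z

  ≤-trans : x ≤ y → y ≤ z → x ≤ z
  ≤-trans x≤y y≤z z<x = x≤y (≤-<-trans y≤z z<x)

  ≤-antisym : x ≤ y → y ≤ x → x ≈ y
  ≤-antisym {x} {y} x≤y y≤x =
    proj₁ (tight x y) λ x#y → [ y≤x , x≤y ]′ (Equivalence.to #⇔<⊎> x#y)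

  ≤-isPreorder : IsPreorder _≈_ _≤_
  ≤-isPreorder = record
    { isEquivalence = isEquivalence
    ; reflexive     = ≤-reflexive
    ; trans         = ≤-trans
    }

  module ≤-Reasoning = TripleReasoning
    ≤-isPreorder <-asym <-trans (<-respʳ-≈ , <-respˡ-≈) <⇒≤ <-≤-trans ≤-<-trans
  open ≤-Reasoning

  -- The order is undecidable, but ≤ is a negation and hence may be proved by cases.
  ≤-cases : ∀ x y → (x ≤ y → z ≤ w) → (y < x → z ≤ w) → z ≤ w
  ≤-cases x y f g w<z = f (λ y<x → g y<x w<z) w<z

  +-monoˡ-< : ∀ z → x < y → x + z < y + z
  +-monoˡ-< z x<y = <-respˡ-≈ (+-comm z _) (<-respʳ-≈ (+-comm z _) (+-monoʳ-< z x<y))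

  x<y⇒0<y-x : x < y → 0# < y - x
  x<y⇒0<y-x {x} x<y = <-respˡ-≈ (-‿inverseʳ x) (+-monoˡ-< (- x) x<y)

  0<d⇒x<x+d : ∀ x → 0# < d → x < x + d
  0<d⇒x<x+d x 0<d = <-respˡ-≈ (+-identityʳ x) (+-monoʳ-< x 0<d)

  +-cancelˡ-< : ∀ z → z + x < z + y → x < y
  +-cancelˡ-< {x} {y} z lt = <-respˡ-≈ (lemma z x) (<-respʳ-≈ (lemma z y) (+-monoʳ-< (- z) lt))
    where
    lemma : ∀ z x → - z + (z + x) ≈ x
    lemma = solve 2 (λ z x → :- z :+ (z :+ x) := x) refl

  +-monoʳ-≤ : ∀ z → x ≤ y → z + x ≤ z + y
  +-monoʳ-≤ z x≤y lt = x≤y (+-cancelˡ-< z lt)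

  +-monoˡ-≤ : ∀ z → x ≤ y → x + z ≤ y + z
  +-monoˡ-≤ {x} {y} z x≤y = begin
    x + z   ≈⟨ +-comm x z ⟩
    z + x   ≤⟨ +-monoʳ-≤ z x≤y ⟩
    z + y   ≈⟨ +-comm z y ⟩
    y + z   ∎

  +-mono-≤ : x ≤ y → z ≤ w → x + z ≤ y + w
  +-mono-≤ {y = y} {z = z} x≤y z≤w = ≤-trans (+-monoˡ-≤ z x≤y) (+-monoʳ-≤ y z≤w)

  +-nonneg : 0# ≤ x → 0# ≤ y → 0# ≤ x + y
  +-nonneg 0≤x 0≤y = ≤-trans (≤-reflexive (sym (+-identityʳ 0#))) (+-mono-≤ 0≤x 0≤y)

  x≤y⇒0≤y-x : x ≤ y → 0# ≤ y - x
  x≤y⇒0≤y-x {x} x≤y = ≤-trans (≤-reflexive (sym (-‿inverseʳ x))) (+-monoˡ-≤ (- x) x≤y)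

  -- Inequalities are mostly proved by exhibiting the difference as a
  -- nonnegative term; the equation is then left to the ring solver.
  ≤-by-difference : 0# ≤ d → x + d ≈ y → x ≤ y
  ≤-by-difference {d} {x} {y} 0≤d x+d≈y = begin
    x        ≈⟨ +-identityʳ x ⟨
    x + 0#   ≤⟨ +-monoʳ-≤ x 0≤d ⟩
    x + d    ≈⟨ x+d≈y ⟩
    y        ∎

  neg-≤ : x ≤ y → - y ≤ - x
  neg-≤ {x} {y} x≤y = ≤-by-difference (x≤y⇒0≤y-x x≤y)
    (solve 2 (λ x y → :- y :+ (y :- x) := :- x) refl x y)

  x≤0⇒0≤-x : x ≤ 0# → 0# ≤ - x
  x≤0⇒0≤-x x≤0 = ≤-trans (≤-reflexive (sym -0#≈0#)) (neg-≤ x≤0)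

  -- `*-pos` covers strict signs only. As the goal is a negation, each factor may be taken to be
  -- either positive or, by antisymmetry, equal to 0.
  *-nonneg : 0# ≤ x → 0# ≤ y → 0# ≤ x * y
  *-nonneg {x} {y} 0≤x 0≤y =
    ≤-cases x 0# (λ x≤0 → zero-factor (≤-antisym x≤0 0≤x)) λ 0<x →
    ≤-cases y 0# (λ y≤0 → zero-factorʳ (≤-antisym y≤0 0≤y)) λ 0<y →
    <⇒≤ (*-pos 0<x 0<y)
    where
    zero-factor : x ≈ 0# → 0# ≤ x * y
    zero-factor x≈0 = ≤-reflexive (sym (trans (*-congʳ x≈0) (zeroˡ y)))
    zero-factorʳ : y ≈ 0# → 0# ≤ x * y
    zero-factorʳ y≈0 = ≤-reflexive (sym (trans (*-congˡ y≈0) (zeroʳ x)))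

  ²-nonneg : ∀ x → 0# ≤ x * x
  ²-nonneg x = ≤-cases 0# x (λ 0≤x → *-nonneg 0≤x 0≤x) λ x<0 →
    let 0≤-x = x≤0⇒0≤-x (<⇒≤ x<0) in
    ≤-trans (*-nonneg 0≤-x 0≤-x) (≤-reflexive (solve 1 (λ x → :- x :* :- x := x :* x) refl x))

  *-monoˡ-≤ : 0# ≤ z → x ≤ y → z * x ≤ z * y
  *-monoˡ-≤ {z} {x} {y} 0≤z x≤y = ≤-by-difference (*-nonneg 0≤z (x≤y⇒0≤y-x x≤y))
    (solve 3 (λ x y z → z :* x :+ z :* (y :- x) := z :* y) refl x y z)

  *-monoʳ-≤ : 0# ≤ z → x ≤ y → x * z ≤ y * z
  *-monoʳ-≤ {z} {x} {y} 0≤z x≤y = ≤-by-difference (*-nonneg (x≤y⇒0≤y-x x≤y) 0≤z)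
    (solve 3 (λ x y z → x :* z :+ (y :- x) :* z := y :* z) refl x y z)

  *-mono-≤ : 0# ≤ x → 0# ≤ z → x ≤ y → z ≤ w → x * z ≤ y * w
  *-mono-≤ 0≤x 0≤z x≤y z≤w = ≤-trans (*-monoʳ-≤ 0≤z x≤y) (*-monoˡ-≤ (≤-trans 0≤x x≤y) z≤w)

  *-monoˡ-< : 0# < z → x < y → z * x < z * y
  *-monoˡ-< {z} {x} {y} 0<z x<y = <-respʳ-≈
    (solve 3 (λ x y z → z :* x :+ z :* (y :- x) := z :* y) refl x y z)
    (0<d⇒x<x+d (z * x) (*-pos 0<z (x<y⇒0<y-x x<y)))

  *-cancelˡ-≤ : 0# < z → z * x ≤ z * y → x ≤ y
  *-cancelˡ-≤ 0<z zx≤zy y<x = zx≤zy (*-monoˡ-< 0<z y<x)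

  0≤1 : 0# ≤ 1#
  0≤1 = <⇒≤ 0<1

  -- Halving without a division: some terms below are shown nonnegative by writing their double as a
  -- sum of nonnegative terms.
  0≤x+x⇒0≤x : 0# ≤ x + x → 0# ≤ x
  0≤x+x⇒0≤x {x} 0≤x+x x<0 = 0≤x+x (<-trans
    (<-respʳ-≈ (+-identityʳ x) (+-monoʳ-< x x<0)) x<0)

  ^-nonneg : ∀ n → 0# ≤ x → 0# ≤ x ^ n
  ^-nonneg zero    0≤x = 0≤1
  ^-nonneg (suc n) 0≤x = *-nonneg 0≤x (^-nonneg n 0≤x)

  ^-mono-≤ : ∀ n → 0# ≤ x → x ≤ y → x ^ n ≤ y ^ n
  ^-mono-≤ zero    0≤x x≤y = ≤-refl
  ^-mono-≤ (suc n) 0≤x x≤y = *-mono-≤ 0≤x (^-nonneg n 0≤x) x≤y (^-mono-≤ n 0≤x x≤y)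

  1^n≈1 : ∀ n → 1# ^ n ≈ 1#
  1^n≈1 zero    = refl
  1^n≈1 (suc n) = trans (*-identityˡ _) (1^n≈1 n)

  fromℕ-nonneg : ∀ n → 0# ≤ fromℕ n
  fromℕ-nonneg zero    = ≤-refl
  fromℕ-nonneg (suc n) = +-nonneg 0≤1 (fromℕ-nonneg n)

  infix 8 _⁻¹[_]
  _⁻¹[_] : ∀ x → x # 0# → Carrier
  x ⁻¹[ x#0 ] = proj₁ (#⇒invertible x#0)

  x-0≈x : ∀ x → x - 0# ≈ x
  x-0≈x x = trans (+-congˡ -0#≈0#) (+-identityʳ x)

  *-inverseʳ : (x#0 : x # 0#) → x * x ⁻¹[ x#0 ] ≈ 1#
  *-inverseʳ {x} x#0 = trans (*-congʳ (sym (x-0≈x x))) (proj₂ (proj₂ (#⇒invertible x#0)))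

  -- Being invertible, y is apart from 0 and so has a decided sign; a negative y would make 1 = x *
  -- y negative.
  x*y≈1⇒0<y : 0# < x → x * y ≈ 1# → 0# < y
  x*y≈1⇒0<y {x} {y} 0<x xy≈1 with Equivalence.to #⇔<⊎> y#0
    where
    x*[y-0]≈1 : x * (y - 0#) ≈ 1#
    x*[y-0]≈1 = trans (*-congˡ (x-0≈x y)) xy≈1
    y#0 : y # 0#
    y#0 = invertible⇒# (x , x*[y-0]≈1 , trans (*-comm _ x) x*[y-0]≈1)
  ... | inj₂ 0<y = 0<y
  ... | inj₁ y<0 = ⊥-elim (<-asym 0<1
    (<-respˡ-≈ xy≈1 (<-respʳ-≈ (zeroʳ x) (*-monoˡ-< 0<x y<0))))

  ⁻¹-pos : (0<x : 0# < x) → 0# < x ⁻¹[ pos⇒#0 0<x ]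
  ⁻¹-pos 0<x = x*y≈1⇒0<y 0<x (*-inverseʳ (pos⇒#0 0<x))

  x≤∣x∣ : ∀ x → x ≤ ∣ x ∣
  x≤∣x∣ x = proj₁ (⊔-supremum x (- x))

  -x≤∣x∣ : ∀ x → - x ≤ ∣ x ∣
  -x≤∣x∣ x = proj₁ (proj₂ (⊔-supremum x (- x)))

  ∣x∣≤ : x ≤ y → - x ≤ y → ∣ x ∣ ≤ y
  ∣x∣≤ {x} {y} = proj₂ (proj₂ (⊔-supremum x (- x))) y

  0<∣x∣ : x # 0# → 0# < ∣ x ∣
  0<∣x∣ {x} x#0 with Equivalence.to #⇔<⊎> x#0
  ... | inj₁ x<0 = <-≤-trans (<-respʳ-≈ (+-identityˡ (- x)) (x<y⇒0<y-x x<0)) (-x≤∣x∣ x)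
  ... | inj₂ 0<x = <-≤-trans 0<x (x≤∣x∣ x)

  ∣x∣²≈x² : x # 0# → ∣ x ∣ * ∣ x ∣ ≈ x * x
  ∣x∣²≈x² {x} x#0 with Equivalence.to #⇔<⊎> x#0
  ... | inj₁ x<0 = trans (*-cong ∣x∣≈-x ∣x∣≈-x) (solve 1 (λ x → :- x :* :- x := x :* x) refl x)
    where
    0≤-x : 0# ≤ - x
    0≤-x = x≤0⇒0≤-x (<⇒≤ x<0)
    ∣x∣≈-x : ∣ x ∣ ≈ - x
    ∣x∣≈-x = ≤-antisym (∣x∣≤ (≤-trans (<⇒≤ x<0) 0≤-x) ≤-refl) (-x≤∣x∣ x)
  ... | inj₂ 0<x = *-cong ∣x∣≈x ∣x∣≈x
    where
    -x≤0 : - x ≤ 0#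
    -x≤0 = ≤-trans (neg-≤ (<⇒≤ 0<x)) (≤-reflexive -0#≈0#)
    ∣x∣≈x : ∣ x ∣ ≈ x
    ∣x∣≈x = ≤-antisym (∣x∣≤ ≤-refl (≤-trans -x≤0 (<⇒≤ 0<x))) (x≤∣x∣ x)

  -- With tolerance l - x, eventually l - u n ≤ |u n - l| < l - x.
  ⟶-eventually-> : ∀ {u l} → u ⟶ l → x < l → ∃ λ N → ∀ n → N ℕ.≤ n → x < u n
  ⟶-eventually-> {x} {u} {l} u⟶l x<l with u⟶l (l - x) (x<y⇒0<y-x x<l)
  ... | N , close = N , λ n N≤n → +-cancelˡ-< (l - x - u n) (<-respˡ-≈
      (solve 3 (λ x l u → :- (u :- l) := l :- x :- u :+ x) refl x l (u n))
      (<-respʳ-≈ (solve 3 (λ x l u → l :- x := l :- x :- u :+ u) refl x l (u n))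
        (≤-<-trans (-x≤∣x∣ (u n - l)) (close n N≤n))))

  -- μ plays the role of 1/m.
  small-reciprocal : ∀ x → ∃ λ m → ∃ λ μ → NonZero m × 0# < μ × fromℕ m * μ ≈ 1# × x * μ < 1#
  small-reciprocal x with archimedean x
  ... | n , x<n = suc n , μ , _ , 0<μ , mμ≈1 , xμ<1
    where
    m = fromℕ (suc n)
    0<m = fromℕ-pos (suc n)
    μ = m ⁻¹[ pos⇒#0 0<m ]
    0<μ = ⁻¹-pos 0<m
    mμ≈1 = *-inverseʳ (pos⇒#0 0<m)
    x<m : x < m
    x<m = <-≤-trans x<n (≤-by-difference 0≤1 (+-comm (fromℕ n) 1#))
    xμ<1 : x * μ < 1#
    xμ<1 = <-respˡ-≈ (*-comm μ x) (<-respʳ-≈ (trans (*-comm μ m) mμ≈1) (*-monoˡ-< 0<μ x<m))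

-- Truncated exponential series.

module ExponentialSeries {c ℓ₁ ℓ₂} (ℝ : RealNumbers c ℓ₁ ℓ₂) where
  open RealNumbers ℝ hiding (zero)
  open OrderedField ℝ
  open ≤-Reasoning
  open MultProperties (CommutativeRing.semiring commutativeRing) using (×1-homo-*)
  open ExpProperties (CommutativeRing.commutativeSemiring commutativeRing) using (^-congˡ)

  private variable
    h w x y z : Carrier

  -- Passage to the limit m → ∞ by contradiction: if y < x, some m is so large that both b/m ≤ 1 and
  -- d/m < x - y, against the bound. The premise `b * μ ≤ 1#` means that the estimate is required
  -- for large m only.
  ≤-by-vanishing : ∀ {b d} → 0# ≤ b → 0# ≤ d →
    (∀ m μ .{{_ : NonZero m}} → 0# < μ → fromℕ m * μ ≈ 1# → b * μ ≤ 1# → x ≤ y + d * μ) →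
    x ≤ y
  ≤-by-vanishing {x} {y} {b} {d} 0≤b 0≤d bound y<x =
    -- One Archimedean choice meets both conditions; `r` is 1/(x - y).
    let m , μ , m≢0 , 0<μ , mμ≈1 , small = small-reciprocal (b + d * r)
    in contradict m μ {{m≢0}} 0<μ mμ≈1 small
    where
    e = x - y
    0<e = x<y⇒0<y-x y<x
    r = e ⁻¹[ pos⇒#0 0<e ]
    0≤r = <⇒≤ (⁻¹-pos 0<e)
    contradict : ∀ m μ .{{_ : NonZero m}} → 0# < μ → fromℕ m * μ ≈ 1# → ¬ (b + d * r) * μ < 1#
    contradict m μ 0<μ mμ≈1 small = bound m μ 0<μ mμ≈1 bμ≤1 (begin-strict
      y + d * μ              ≈⟨ +-congˡ dμ≈e[drμ] ⟩
      y + e * (d * r * μ)    <⟨ +-monoʳ-< y (*-monoˡ-< 0<e drμ<1) ⟩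
      y + e * 1#             ≈⟨ solve 2 (λ x y → y :+ (x :- y) :* :1 := x) refl x y ⟩
      x                      ∎)
      where
      bμ≤1 : b * μ ≤ 1#
      bμ≤1 = ≤-trans
        (*-monoʳ-≤ (<⇒≤ 0<μ) (≤-by-difference (*-nonneg 0≤d 0≤r) refl)) (<⇒≤ small)
      drμ<1 : d * r * μ < 1#
      drμ<1 = ≤-<-trans
        (*-monoʳ-≤ (<⇒≤ 0<μ) (≤-by-difference 0≤b (+-comm _ _))) small
      dμ≈e[drμ] : d * μ ≈ e * (d * r * μ)
      dμ≈e[drμ] = begin-equality
        d * μ                ≈⟨ *-identityˡ _ ⟨
        1# * (d * μ)         ≈⟨ *-congʳ (*-inverseʳ (pos⇒#0 0<e)) ⟨
        e * r * (d * μ)      ≈⟨ solve 4 (λ e r d μ → e :* r :* (d :* μ) := e :* (d :* r :* μ)) refl e r d μ ⟩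
        e * (d * r * μ)      ∎

  -- Convexity of the power function: its tangent at w lies below the graph. In the induction,
  -- multiplying by w + h leaves the nonnegative surplus `s * (h * h) * p`.
  w^n-tangent-≤ : ∀ n → 0# ≤ w → 0# ≤ h →
    w ^ suc n + fromℕ (suc n) * (h * w ^ n) ≤ (w + h) ^ suc n
  w^n-tangent-≤ {w} {h} zero 0≤w 0≤h = ≤-reflexive
    (solve 2 (λ w h → w :* :1 :+ (:1 :+ :0) :* (h :* :1) := (w :+ h) :* :1) refl w h)
  w^n-tangent-≤ {w} {h} (suc n) 0≤w 0≤h = begin
    w * (w * p) + (1# + s) * (h * (w * p))
      ≤⟨ ≤-by-difference
           (*-nonneg (*-nonneg (fromℕ-nonneg (suc n)) (*-nonneg 0≤h 0≤h)) (^-nonneg n 0≤w))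
           (solve 4 (λ w h p s →
              w :* (w :* p) :+ (:1 :+ s) :* (h :* (w :* p)) :+ s :* (h :* h) :* p
                := (w :+ h) :* (w :* p :+ s :* (h :* p))) refl w h p s) ⟩
    (w + h) * (w * p + s * (h * p))
      ≤⟨ *-monoˡ-≤ (+-nonneg 0≤w 0≤h) (w^n-tangent-≤ n 0≤w 0≤h) ⟩
    (w + h) * (w + h) ^ suc n  ∎
    where
    p = w ^ n
    s = fromℕ (suc n)

  -- The companion of `w^n-tangent-≤`, with the slope taken at the right end w + h.
  [w+h]^n-tangent-≥ : ∀ n → 0# ≤ w → 0# ≤ h →
    (w + h) ^ suc n ≤ w ^ suc n + fromℕ (suc n) * (h * (w + h) ^ n)
  [w+h]^n-tangent-≥ {w} {h} zero 0≤w 0≤h = ≤-reflexive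
    (solve 2 (λ w h → (w :+ h) :* :1 := w :* :1 :+ (:1 :+ :0) :* (h :* :1)) refl w h)
  [w+h]^n-tangent-≥ {w} {h} (suc n) 0≤w 0≤h = begin
    (w + h) * ((w + h) * q)
      ≈⟨ distribʳ ((w + h) * q) w h ⟩
    w * ((w + h) * q) + h * ((w + h) * q)
      ≤⟨ +-monoˡ-≤ _ (*-monoˡ-≤ 0≤w ([w+h]^n-tangent-≥ n 0≤w 0≤h)) ⟩
    w * (p + s * (h * q)) + h * ((w + h) * q)
      ≤⟨ ≤-by-difference
           (*-nonneg (*-nonneg (fromℕ-nonneg (suc n)) (*-nonneg 0≤h 0≤h)) (^-nonneg n (+-nonneg 0≤w 0≤h)))
           (solve 5 (λ w h p q s →
              w :* (p :+ s :* (h :* q)) :+ h :* ((w :+ h) :* q) :+ s :* (h :* h) :* q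
                := w :* p :+ (:1 :+ s) :* (h :* ((w :+ h) :* q))) refl w h p q s) ⟩
    w * p + (1# + s) * (h * ((w + h) * q))  ∎
    where
    p = w ^ suc n
    q = (w + h) ^ n
    s = fromℕ (suc n)

  1/_! : ℕ → Carrier
  1/ k ! = fromℕ (k !) ⁻¹[ fromℕ#0 (k !) {{k ℕ.!≢0}} ]

  1/k!-inverse : ∀ k → fromℕ (k !) * 1/ k ! ≈ 1#
  1/k!-inverse k = *-inverseʳ (fromℕ#0 (k !) {{k ℕ.!≢0}})

  1/k!-nonneg : ∀ k → 0# ≤ 1/ k !
  1/k!-nonneg k = <⇒≤ (x*y≈1⇒0<y (fromℕ-pos (k !) {{k ℕ.!≢0}}) (1/k!-inverse k))

  -- Makes `term k` the derivative of `term (suc k)`, so that tangent bounds for powers become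
  -- tangent bounds for terms.
  1/k!-suc : ∀ k → 1/ k ! ≈ fromℕ (suc k) * 1/ suc k !
  1/k!-suc k = begin-equality
    1/ k !
      ≈⟨ *-identityʳ _ ⟨
    1/ k ! * 1#
      ≈⟨ *-congˡ (1/k!-inverse (suc k)) ⟨
    1/ k ! * (fromℕ (suc k ℕ.* k !) * 1/ suc k !)
      ≈⟨ *-congˡ (*-congʳ (×1-homo-* (suc k) (k !))) ⟩
    1/ k ! * (fromℕ (suc k) * fromℕ (k !) * 1/ suc k !)
      ≈⟨ solve 4 (λ i s f j → i :* (s :* f :* j) := f :* i :* (s :* j)) refl
              (1/ k !) (fromℕ (suc k)) (fromℕ (k !)) (1/ suc k !) ⟩
    fromℕ (k !) * 1/ k ! * (fromℕ (suc k) * 1/ suc k !)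
      ≈⟨ *-congʳ (1/k!-inverse k) ⟩
    1# * (fromℕ (suc k) * 1/ suc k !)
      ≈⟨ *-identityˡ _ ⟩
    fromℕ (suc k) * 1/ suc k !  ∎

  term : ℕ → Carrier → Carrier
  term k x = x ^ k * 1/ k !

  term-cong : ∀ k → x ≈ y → term k x ≈ term k y
  term-cong k x≈y = *-congʳ (^-congˡ k x≈y)

  term-nonneg : ∀ k → 0# ≤ x → 0# ≤ term k x
  term-nonneg k 0≤x = *-nonneg (^-nonneg k 0≤x) (1/k!-nonneg k)

  term-mono-≤ : ∀ k → 0# ≤ x → x ≤ y → term k x ≤ term k y
  term-mono-≤ k 0≤x x≤y = *-monoʳ-≤ (1/k!-nonneg k) (^-mono-≤ k 0≤x x≤y)

  term-tangent : ∀ k w p → (w ^ suc k + fromℕ (suc k) * (h * p)) * 1/ suc k ! ≈ term (suc k) w + h * (p * 1/ k !)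
  term-tangent {h} k w p = trans
    (solve 5 (λ W s h p j → (W :+ s :* (h :* p)) :* j := W :* j :+ h :* (p :* (s :* j))) refl
      (w ^ suc k) (fromℕ (suc k)) h p (1/ suc k !))
    (+-congˡ (*-congˡ (*-congˡ (sym (1/k!-suc k)))))

  term-tangent-≤ : ∀ k → 0# ≤ w → 0# ≤ h → term (suc k) w + h * term k w ≤ term (suc k) (w + h)
  term-tangent-≤ {w} k 0≤w 0≤h = ≤-trans (≤-reflexive (sym (term-tangent k w (w ^ k))))
    (*-monoʳ-≤ (1/k!-nonneg (suc k)) (w^n-tangent-≤ k 0≤w 0≤h))

  term-tangent-≥ : ∀ k → 0# ≤ w → 0# ≤ h → term (suc k) (w + h) ≤ term (suc k) w + h * term k (w + h)
  term-tangent-≥ {w} {h} k 0≤w 0≤h = ≤-trans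
    (*-monoʳ-≤ (1/k!-nonneg (suc k)) ([w+h]^n-tangent-≥ k 0≤w 0≤h))
    (≤-reflexive (term-tangent k w ((w + h) ^ k)))

  -- The newest term is added on the right, unlike in `sum`, so that lengthening the series by one
  -- term is definitional.
  partialSum : (ℕ → Carrier) → ℕ → Carrier
  partialSum f zero    = 0#
  partialSum f (suc n) = partialSum f n + f n

  partialSum-suc : ∀ f n → partialSum f (suc n) ≈ f 0 + partialSum (f ∘ suc) n
  partialSum-suc f zero    = +-comm 0# (f 0)
  partialSum-suc f (suc n) = trans (+-congʳ (partialSum-suc f n)) (+-assoc _ _ _)

  sum≈partialSum : ∀ f n → sum {n} (f ∘ toℕ) ≈ partialSum f n
  sum≈partialSum f zero    = refl
  sum≈partialSum f (suc n) = trans (+-congˡ (sum≈partialSum (f ∘ suc) n)) (sym (partialSum-suc f n))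

  exp[_] : ℕ → Carrier → Carrier
  exp[ n ] x = partialSum (λ k → term k x) n

  expSum≈exp : ∀ n x → expSum x n ≈ exp[ n ] x
  expSum≈exp n x = sum≈partialSum (λ k → term k x) n

  exp-cong : ∀ n → x ≈ y → exp[ n ] x ≈ exp[ n ] y
  exp-cong zero    x≈y = refl
  exp-cong (suc n) x≈y = +-cong (exp-cong n x≈y) (term-cong n x≈y)

  exp-nonneg : ∀ n → 0# ≤ x → 0# ≤ exp[ n ] x
  exp-nonneg zero    0≤x = ≤-refl
  exp-nonneg (suc n) 0≤x = +-nonneg (exp-nonneg n 0≤x) (term-nonneg n 0≤x)

  term-0 : ∀ x → term 0 x ≈ 1#
  term-0 x = trans (*-congʳ (sym (+-identityʳ 1#))) (1/k!-inverse 0)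

  exp0≈1 : ∀ n → exp[ suc n ] 0# ≈ 1#
  exp0≈1 zero    = trans (+-identityˡ _) (term-0 0#)
  exp0≈1 (suc n) = trans (+-cong (exp0≈1 n) (trans (*-congʳ (zeroˡ _)) (zeroˡ _))) (+-identityʳ 1#)

  exp0≤1 : ∀ n → exp[ n ] 0# ≤ 1#
  exp0≤1 zero    = 0≤1
  exp0≤1 (suc n) = ≤-reflexive (exp0≈1 n)

  -- `term-tangent-≥` summed over the terms. Differentiation shifts the series by one, so the slope
  -- has one term fewer than the sum.
  exp-tangent-≥ : ∀ n → 0# ≤ w → 0# ≤ h → exp[ suc n ] (w + h) ≤ exp[ suc n ] w + h * exp[ n ] (w + h)
  exp-tangent-≥ {w} {h} zero 0≤w 0≤h = ≤-reflexive (solve 2 (λ h t → :0 :+ t := :0 :+ t :+ h :* :0) refl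
          h (1# * 1/ 0 !))
  exp-tangent-≥ {w} {h} (suc n) 0≤w 0≤h = begin
    exp[ suc n ] (w + h) + term (suc n) (w + h)
      ≤⟨ +-mono-≤ (exp-tangent-≥ n 0≤w 0≤h) (term-tangent-≥ n 0≤w 0≤h) ⟩
    (exp[ suc n ] w + h * exp[ n ] (w + h)) + (term (suc n) w + h * term n (w + h))
      ≈⟨ solve 5 (λ a h b c d → (a :+ h :* b) :+ (c :+ h :* d) := a :+ c :+ h :* (b :+ d)) refl _ _ _ _ _ ⟩
    exp[ suc n ] w + term (suc n) w + h * (exp[ n ] (w + h) + term n (w + h))  ∎

  -- Here 1 - h acts as exp(-h): complete the slope in `exp-tangent-≥` by its missing nonnegative
  -- term and collect.
  exp-shift-≤ : ∀ n → 0# ≤ w → 0# ≤ h → exp[ n ] (w + h) * (1# - h) ≤ exp[ n ] w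
  exp-shift-≤ {w} {h} zero    0≤w 0≤h = ≤-reflexive (zeroˡ _)
  exp-shift-≤ {w} {h} (suc n) 0≤w 0≤h = begin
    E * (1# - h)                                    ≈⟨ solve 2 (λ E h → E :* (:1 :- h) := E :- h :* E) refl E h ⟩
    E - h * E                                       ≤⟨ +-monoˡ-≤ _ (exp-tangent-≥ n 0≤w 0≤h) ⟩
    exp[ suc n ] w + h * exp[ n ] (w + h) - h * E   ≤⟨ ≤-by-difference (*-nonneg 0≤h (term-nonneg n (+-nonneg 0≤w 0≤h)))
        (solve 4 (λ a h b t → a :+ h :* b :- h :* (b :+ t) :+ h :* t := a) refl _ h _ _) ⟩
    exp[ suc n ] w                                  ∎
    where E = exp[ suc n ] (w + h)

  -- Walks from j * y down to 0 in j steps of length y. With y = L/m and j = m it bounds the partial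
  -- sums of exp L.
  exp[jy]*[1-y]^j≤1 : ∀ n j → 0# ≤ y → y ≤ 1# → exp[ n ] (fromℕ j * y) * (1# - y) ^ j ≤ 1#
  exp[jy]*[1-y]^j≤1 {y} n zero 0≤y y≤1 = begin
    exp[ n ] (0# * y) * 1#   ≈⟨ *-identityʳ _ ⟩
    exp[ n ] (0# * y)        ≈⟨ exp-cong n (zeroˡ y) ⟩
    exp[ n ] 0#              ≤⟨ exp0≤1 n ⟩
    1#                       ∎
  exp[jy]*[1-y]^j≤1 {y} n (suc j) 0≤y y≤1 = begin
    exp[ n ] ((1# + fromℕ j) * y) * ((1# - y) * (1# - y) ^ j)
      ≈⟨ *-congʳ (exp-cong n (solve 2 (λ j y → (:1 :+ j) :* y := j :* y :+ y) refl (fromℕ j) y)) ⟩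
    exp[ n ] (fromℕ j * y + y) * ((1# - y) * (1# - y) ^ j)
      ≈⟨ *-assoc _ _ _ ⟨
    exp[ n ] (fromℕ j * y + y) * (1# - y) * (1# - y) ^ j
      ≤⟨ *-monoʳ-≤ (^-nonneg j (x≤y⇒0≤y-x y≤1)) (exp-shift-≤ n (*-nonneg (fromℕ-nonneg j) 0≤y) 0≤y) ⟩
    exp[ n ] (fromℕ j * y) * (1# - y) ^ j
      ≤⟨ exp[jy]*[1-y]^j≤1 n j 0≤y y≤1 ⟩
    1#  ∎

  -- Recursive rather than n + n, so that `double (suc k)` unfolds to two successors and consecutive
  -- terms pair off.
  double : ℕ → ℕ
  double zero    = zero
  double (suc k) = suc (suc (double k))

  n≤double : ∀ n → n ℕ.≤ double n
  n≤double zero    = ℕ.z≤n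
  n≤double (suc n) = ℕ.s≤s (ℕ.m≤n⇒m≤1+n (n≤double n))

  -- exp(-w) truncated after an even number of terms.
  exp⁻[_] : ℕ → Carrier → Carrier
  exp⁻[ n ] w = partialSum (λ k → term (double k) w - term (suc (double k)) w) n

  neg-^-double : ∀ k w → (- w) ^ double k ≈ w ^ double k
  neg-^-double zero    w = refl
  neg-^-double (suc k) w = trans (*-congˡ (*-congˡ (neg-^-double k w)))
    (solve 2 (λ w p → :- w :* (:- w :* p) := w :* (w :* p)) refl w (w ^ double k))

  exp-neg : ∀ n w → exp[ double n ] (- w) ≈ exp⁻[ n ] w
  exp-neg zero    w = refl
  exp-neg (suc n) w = trans
    (+-cong (+-cong (exp-neg n w) (*-congʳ (neg-^-double n w))) (*-congʳ (*-congˡ (neg-^-double n w))))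
    (solve 5 (λ E p i w j → E :+ p :* i :+ :- w :* p :* j := E :+ (p :* i :- w :* p :* j)) refl
      (exp⁻[ n ] w) (w ^ double n) (1/ double n !) w (1/ suc (double n) !))

  -- The coefficient of h² in the error of one Euler step for exp(-w).
  evenPart : ℕ → Carrier → Carrier
  evenPart n w = partialSum (λ k → term (double k) w) n

  evenPart-nonneg : ∀ n → 0# ≤ w → 0# ≤ evenPart n w
  evenPart-nonneg zero    0≤w = ≤-refl
  evenPart-nonneg (suc n) 0≤w = +-nonneg (evenPart-nonneg n 0≤w) (term-nonneg (double n) 0≤w)

  evenPart-mono-≤ : ∀ n → 0# ≤ x → x ≤ y → evenPart n x ≤ evenPart n y
  evenPart-mono-≤ zero    0≤x x≤y = ≤-refl
  evenPart-mono-≤ (suc n) 0≤x x≤y = +-mono-≤ (evenPart-mono-≤ n 0≤x x≤y) (term-mono-≤ (double n) 0≤x x≤y)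

  -- Up to O(h²), a discrete form of f′ = -f - `term (suc (double n))` for f = `exp⁻[ suc n ]`:
  -- differentiating the alternating sum shifts it by one, and the last term is left over. Because
  -- the sum ends with a subtracted term, the leftover has the sign that allows it to be dropped in
  -- `exp⁻-step`.
  exp⁻-tangent : ∀ n → 0# ≤ w → 0# ≤ h →
    exp⁻[ suc n ] (w + h) + h * term (suc (double n)) w
      ≤ exp⁻[ suc n ] w - h * exp⁻[ suc n ] w + h * h * evenPart n (w + h)
  exp⁻-tangent {w} {h} zero 0≤w 0≤h = ≤-by-difference (x≤y⇒0≤y-x (term-tangent-≤ 0 0≤w 0≤h))
    (solve 4 (λ h t u v →
       (:0 :+ (t :- v)) :+ h :* u :+ (v :- (u :+ h :* t))
         := (:0 :+ (t :- u)) :- h :* (:0 :+ (t :- u)) :+ h :* h :* :0) refl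
      h (term 0 w) (term 1 w) (term 1 (w + h)))
  -- The subtracted odd term is estimated with its slope at w. The even term has its slope at w + h,
  -- and moving that slope back to w costs the h² times the new term of `evenPart`.
  exp⁻-tangent {w} {h} (suc n) 0≤w 0≤h = ≤-by-difference
    (+-nonneg (+-nonneg (x≤y⇒0≤y-x (exp⁻-tangent n 0≤w 0≤h))
                        (x≤y⇒0≤y-x (term-tangent-≤ (suc (suc (double n))) 0≤w 0≤h)))
              (+-nonneg (x≤y⇒0≤y-x (term-tangent-≥ (suc (double n)) 0≤w 0≤h))
                        (*-nonneg 0≤h (x≤y⇒0≤y-x (term-tangent-≥ (double n) 0≤w 0≤h)))))
    (combine h (exp⁻[ suc n ] (w + h)) (exp⁻[ suc n ] w) (evenPart n (w + h)) (term (double n) (w + h))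
      (term (suc (double n)) w) (term (suc (double n)) (w + h))
      (term (double (suc n)) w) (term (double (suc n)) (w + h))
      (term (suc (double (suc n))) w) (term (suc (double (suc n))) (w + h)))
    where
    combine : ∀ h D′ D M c′ e e′ f f′ g g′ →
      (D′ + (f′ - g′)) + h * g
        + (((D - h * D + h * h * M) - (D′ + h * e)) + (g′ - (g + h * f))
            + ((f + h * e′ - f′) + h * (e + h * c′ - e′)))
      ≈ (D + (f - g)) - h * (D + (f - g)) + h * h * (M + c′)
    combine = solve 11 (λ h D′ D M c′ e e′ f f′ g g′ →
      (D′ :+ (f′ :- g′)) :+ h :* g
        :+ (((D :- h :* D :+ h :* h :* M) :- (D′ :+ h :* e)) :+ (g′ :- (g :+ h :* f))
            :+ ((f :+ h :* e′ :- f′) :+ h :* (e :+ h :* c′ :- e′)))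
      := (D :+ (f :- g)) :- h :* (D :+ (f :- g)) :+ h :* h :* (M :+ c′)) refl

  exp⁻-step : ∀ n → 0# ≤ w → 0# ≤ h →
    exp⁻[ suc n ] (w + h) ≤ exp⁻[ suc n ] w * (1# - h) + h * h * evenPart n (w + h)
  exp⁻-step {w} {h} n 0≤w 0≤h = begin
    exp⁻[ suc n ] (w + h)
      ≤⟨ ≤-by-difference (*-nonneg 0≤h (term-nonneg (suc (double n)) 0≤w)) refl ⟩
    exp⁻[ suc n ] (w + h) + h * term (suc (double n)) w
      ≤⟨ exp⁻-tangent n 0≤w 0≤h ⟩
    exp⁻[ suc n ] w - h * exp⁻[ suc n ] w + h * h * evenPart n (w + h)
      ≈⟨ +-congʳ (solve 2 (λ E h → E :- h :* E := E :* (:1 :- h)) refl _ h) ⟩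
    exp⁻[ suc n ] w * (1# - h) + h * h * evenPart n (w + h)  ∎

  exp⁻-cong : ∀ n → x ≈ y → exp⁻[ n ] x ≈ exp⁻[ n ] y
  exp⁻-cong zero    x≈y = refl
  exp⁻-cong (suc n) x≈y = +-cong (exp⁻-cong n x≈y)
    (+-cong (term-cong (double n) x≈y) (-‿cong (term-cong (suc (double n)) x≈y)))

  -- The factor 1 - h is at most 1, so the errors of the j steps merely add up. The common endpoint
  -- bound y lets one value of `evenPart` serve all steps.
  exp⁻-multiple-≤ : ∀ n j → 0# ≤ h → h ≤ 1# → fromℕ j * h ≤ y →
    exp⁻[ suc n ] (fromℕ j * h) ≤ 1# + fromℕ j * (h * h * evenPart n y)
  exp⁻-multiple-≤ {h} {y} n zero 0≤h h≤1 jh≤y = begin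
    exp⁻[ suc n ] (0# * h)          ≈⟨ exp-neg (suc n) (0# * h) ⟨
    exp[ double (suc n) ] (- (0# * h))   ≈⟨ exp-cong (double (suc n)) (solve 1 (λ h → :- (:0 :* h) := :0) refl h) ⟩
    exp[ double (suc n) ] 0#        ≤⟨ exp0≤1 (double (suc n)) ⟩
    1#                              ≈⟨ solve 1 (λ m → :1 := :1 :+ :0 :* m) refl _ ⟩
    1# + 0# * (h * h * evenPart n y)  ∎
  exp⁻-multiple-≤ {h} {y} n (suc j) 0≤h h≤1 [1+j]h≤y = begin
    exp⁻[ suc n ] ((1# + fromℕ j) * h)
      ≈⟨ exp⁻-cong (suc n) [1+j]h≈jh+h ⟩
    exp⁻[ suc n ] (fromℕ j * h + h)
      ≤⟨ exp⁻-step n 0≤jh 0≤h ⟩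
    exp⁻[ suc n ] (fromℕ j * h) * (1# - h) + h * h * evenPart n (fromℕ j * h + h)
      ≤⟨ +-mono-≤ (*-monoʳ-≤ (x≤y⇒0≤y-x h≤1) (exp⁻-multiple-≤ n j 0≤h h≤1 jh≤y))
                  (*-monoˡ-≤ (*-nonneg 0≤h 0≤h) (evenPart-mono-≤ n (+-nonneg 0≤jh 0≤h) jh+h≤y)) ⟩
    (1# + fromℕ j * M) * (1# - h) + M
      ≤⟨ ≤-by-difference (*-nonneg (+-nonneg 0≤1 (*-nonneg (fromℕ-nonneg j) 0≤M)) 0≤h)
           (solve 3 (λ j M h → (:1 :+ j :* M) :* (:1 :- h) :+ M :+ (:1 :+ j :* M) :* h := :1 :+ (:1 :+ j) :* M) refl
                   (fromℕ j) M h) ⟩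
    1# + (1# + fromℕ j) * M  ∎
    where
    M = h * h * evenPart n y
    0≤jh = *-nonneg (fromℕ-nonneg j) 0≤h
    [1+j]h≈jh+h : (1# + fromℕ j) * h ≈ fromℕ j * h + h
    [1+j]h≈jh+h = solve 2 (λ j h → (:1 :+ j) :* h := j :* h :+ h) refl (fromℕ j) h
    jh+h≤y : fromℕ j * h + h ≤ y
    jh+h≤y = ≤-trans (≤-reflexive (sym [1+j]h≈jh+h)) [1+j]h≤y
    jh≤y : fromℕ j * h ≤ y
    jh≤y = ≤-trans (≤-by-difference 0≤h refl) jh+h≤y
    0≤M : 0# ≤ M
    0≤M = *-nonneg (*-nonneg 0≤h 0≤h) (evenPart-nonneg n (≤-trans 0≤jh jh≤y))

  -- A discrete version of f′ = -f, f(0) = 1 ⇒ f ≤ 1: in m steps of length y/m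
  -- the truncated exp(-w) grows above 1 by at most O(1/m).
  exp⁻≤1 : ∀ n → 0# ≤ y → exp⁻[ suc n ] y ≤ 1#
  exp⁻≤1 {y} n 0≤y = ≤-by-vanishing 0≤y (*-nonneg (*-nonneg 0≤y 0≤y) (evenPart-nonneg n 0≤y))
    λ m μ 0<μ mμ≈1 yμ≤1 →
    let y≈m[yμ] : y ≈ fromℕ m * (y * μ)
        y≈m[yμ] = trans (sym (*-identityʳ y)) (trans (*-congˡ (sym mμ≈1))
          (solve 3 (λ y m μ → y :* (m :* μ) := m :* (y :* μ)) refl y (fromℕ m) μ))
    in begin
      exp⁻[ suc n ] y
        ≈⟨ exp⁻-cong (suc n) y≈m[yμ] ⟩
      exp⁻[ suc n ] (fromℕ m * (y * μ))
        ≤⟨ exp⁻-multiple-≤ n m (*-nonneg 0≤y (<⇒≤ 0<μ)) yμ≤1 (≤-reflexive (sym y≈m[yμ])) ⟩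
      1# + fromℕ m * (y * μ * (y * μ) * evenPart n y)
        ≈⟨ solve 4 (λ m y μ M → :1 :+ m :* (y :* μ :* (y :* μ) :* M) := :1 :+ y :* y :* M :* μ :* (m :* μ)) refl
                (fromℕ m) y μ _ ⟩
      1# + y * y * evenPart n y * μ * (fromℕ m * μ)
        ≈⟨ +-congˡ (trans (*-congˡ mμ≈1) (*-identityʳ _)) ⟩
      1# + y * y * evenPart n y * μ  ∎

  -- For x < 0 the partial sums of even length are values of `exp⁻` and stay at most 1, so they
  -- cannot approach y > 1. Applied to the logarithm, which is given only by its graph.
  IsExp⇒0≤ : IsExp x y → 1# < y → 0# ≤ x
  IsExp⇒0≤ {x} {y} exp[x]≡y 1<y x<0 =
    let N , large = ⟶-eventually-> exp[x]≡y 1<y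
    -- An index beyond N that is even and positive, the shape that `exp⁻≤1` asks for.
    in expSum≤1 N (large (double (suc N)) (ℕ.≤-trans (ℕ.n≤1+n N) (n≤double (suc N))))
    where
    expSum≤1 : ∀ n → expSum x (double (suc n)) ≤ 1#
    expSum≤1 n = begin
      expSum x (double (suc n))       ≈⟨ expSum≈exp (double (suc n)) x ⟩
      exp[ double (suc n) ] x         ≈⟨ exp-cong (double (suc n)) (-‿involutive x) ⟨
      exp[ double (suc n) ] (- - x)   ≈⟨ exp-neg (suc n) (- x) ⟩
      exp⁻[ suc n ] (- x)             ≤⟨ exp⁻≤1 n (x≤0⇒0≤-x (<⇒≤ x<0)) ⟩
      1#                              ∎

-- Bounds for finite products and powers.

module ProductEstimates {c ℓ₁ ℓ₂} (ℝ : RealNumbers c ℓ₁ ℓ₂) where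
  open RealNumbers ℝ hiding (zero)
  open OrderedField ℝ
  open ≤-Reasoning
  open RawSemiringDefinitions (Semiring.rawSemiring (CommutativeRing.semiring commutativeRing)) public
    using (product)
  open ExpProperties (CommutativeRing.commutativeSemiring commutativeRing) public
    using (^-congˡ; ^-distrib-*; ^-homo-*; ^-assocʳ)

  private variable
    n : ℕ
    x y u σ σ′ τ τ′ P P′ κ κ′ : Carrier

  product-cong : {f g : Vector Carrier n} → (∀ j → f j ≈ g j) → product f ≈ product g
  product-cong {n = zero}  f≈g = refl
  product-cong {n = suc n} f≈g = *-cong (f≈g zero) (product-cong (f≈g ∘ suc))

  product-nonneg : {f : Vector Carrier n} → (∀ j → 0# ≤ f j) → 0# ≤ product f
  product-nonneg {n = zero}  0≤f = 0≤1
  product-nonneg {n = suc n} 0≤f = *-nonneg (0≤f zero) (product-nonneg (0≤f ∘ suc))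

  product-mono-≤ : {f g : Vector Carrier n} → (∀ j → 0# ≤ f j) → (∀ j → f j ≤ g j) → product f ≤ product g
  product-mono-≤ {n = zero}  0≤f f≤g = ≤-refl
  product-mono-≤ {n = suc n} 0≤f f≤g =
    *-mono-≤ (0≤f zero) (product-nonneg (0≤f ∘ suc)) (f≤g zero) (product-mono-≤ (0≤f ∘ suc) (f≤g ∘ suc))

  product-^ : ∀ k (f : Vector Carrier n) → product (λ j → f j ^ k) ≈ product f ^ k
  product-^ {n = zero}  k f = sym (1^n≈1 k)
  product-^ {n = suc n} k f = trans (*-congˡ (product-^ k (f ∘ suc))) (sym (^-distrib-* (f zero) (product (f ∘ suc)) k))

  product-*ˡ : ∀ a (f : Vector Carrier n) → product (λ j → a * f j) ≈ a ^ n * product f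
  product-*ˡ {n = zero}  a f = sym (*-identityˡ 1#)
  product-*ˡ {n = suc n} a f = trans (*-congˡ (product-*ˡ a (f ∘ suc)))
    (solve 4 (λ a x p q → a :* x :* (p :* q) := a :* p :* (x :* q)) refl a (f zero) (a ^ n) (product (f ∘ suc)))

  bernoulli : ∀ n → 0# ≤ 1# + x → 1# + fromℕ n * x ≤ (1# + x) ^ n
  bernoulli {x} zero    0≤1+x = ≤-reflexive (solve 1 (λ x → :1 :+ :0 :* x := :1) refl x)
  bernoulli {x} (suc n) 0≤1+x = begin
    1# + (1# + fromℕ n) * x           ≤⟨ ≤-by-difference (*-nonneg (fromℕ-nonneg n) (²-nonneg x))
      (solve 2 (λ n x → :1 :+ (:1 :+ n) :* x :+ n :* (x :* x) := (:1 :+ x) :* (:1 :+ n :* x)) refl (fromℕ n) x) ⟩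
    (1# + x) * (1# + fromℕ n * x)     ≤⟨ *-monoˡ-≤ 0≤1+x (bernoulli n 0≤1+x) ⟩
    (1# + x) * (1# + x) ^ n           ∎

  1≤^ : ∀ n → 1# ≤ x → 1# ≤ x ^ n
  1≤^ {x} n 1≤x = ≤-trans (≤-reflexive (sym (1^n≈1 n))) (^-mono-≤ n 0≤1 1≤x)

  ^-monoʳ-≤ : ∀ {m n} → 1# ≤ x → m ℕ.≤ n → x ^ m ≤ x ^ n
  ^-monoʳ-≤ {x} {n = n} 1≤x ℕ.z≤n       = 1≤^ n 1≤x
  ^-monoʳ-≤ {x}         1≤x (ℕ.s≤s m≤n) = *-monoˡ-≤ (≤-trans 0≤1 1≤x) (^-monoʳ-≤ 1≤x m≤n)

  -- Closed under products, this says P ≥ 1 + σ up to second order, where τ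
  -- bounds the absolute value of σ.
  record FirstOrderBound (P σ τ : Carrier) : Set ℓ₂ where
    field
      nonneg : 0# ≤ P
      bound  : 1# + σ - τ * τ ≤ P
      -τ≤σ   : 0# ≤ τ + σ
      σ≤τ    : 0# ≤ τ - σ

    0≤τ : 0# ≤ τ
    0≤τ = 0≤x+x⇒0≤x (≤-trans (+-nonneg -τ≤σ σ≤τ)
      (≤-reflexive (solve 2 (λ σ τ → τ :+ σ :+ (τ :- σ) := τ :+ τ) refl σ τ)))

  -- Of the cross term 2ττ′ in (τ + τ′)², one half pays for σσ′ ≥ -ττ′ and the other for the cubic
  -- terms. That τ + τ′ is at most 1/2 makes the second half sufficient and keeps the lower bound
  -- for P′ nonnegative, so that the two lower bounds may be multiplied.
  firstOrderBound-* : FirstOrderBound P σ τ → FirstOrderBound P′ σ′ τ′ →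
    (τ + τ′) + (τ + τ′) ≤ 1# → FirstOrderBound (P * P′) (σ + σ′) (τ + τ′)
  firstOrderBound-* {P} {σ} {τ} {P′} {σ′} {τ′} B B′ small = record
    { nonneg = *-nonneg B.nonneg B′.nonneg
    ; bound  = begin
        1# + (σ + σ′) - (τ + τ′) * (τ + τ′)
          ≤⟨ ≤-by-difference
               (+-nonneg (+-nonneg (+-nonneg (+-nonneg 0≤σσ′+ττ′
                 (*-nonneg 0≤ττ′ (+-nonneg (+-nonneg 0≤slack B.0≤τ) B′.0≤τ)))
                 (*-nonneg B.σ≤τ (²-nonneg τ′)))
                 (*-nonneg (²-nonneg τ) B′.σ≤τ))
                 (*-nonneg (²-nonneg τ) (²-nonneg τ′)))
               (expand σ τ σ′ τ′) ⟩
        (1# + σ - τ * τ) * (1# + σ′ - τ′ * τ′)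
          ≤⟨ *-monoʳ-≤ 0≤bound′ B.bound ⟩
        P * (1# + σ′ - τ′ * τ′)
          ≤⟨ *-monoˡ-≤ B.nonneg B′.bound ⟩
        P * P′  ∎
    ; -τ≤σ   = ≤-trans (+-nonneg B.-τ≤σ B′.-τ≤σ)
        (≤-reflexive (solve 4 (λ σ τ σ′ τ′ → τ :+ σ :+ (τ′ :+ σ′) := τ :+ τ′ :+ (σ :+ σ′)) refl σ τ σ′ τ′))
    ; σ≤τ    = ≤-trans (+-nonneg B.σ≤τ B′.σ≤τ)
        (≤-reflexive (solve 4 (λ σ τ σ′ τ′ → τ :- σ :+ (τ′ :- σ′) := τ :+ τ′ :- (σ :+ σ′)) refl σ τ σ′ τ′))
    }
    where
    module B = FirstOrderBound B
    module B′ = FirstOrderBound B′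
    slack = 1# - ((τ + τ′) + (τ + τ′))
    0≤slack = x≤y⇒0≤y-x small
    0≤ττ′ = *-nonneg B.0≤τ B′.0≤τ
    0≤σσ′+ττ′ : 0# ≤ σ * σ′ + τ * τ′
    0≤σσ′+ττ′ = 0≤x+x⇒0≤x (≤-trans
      (+-nonneg (*-nonneg B.-τ≤σ B′.-τ≤σ) (*-nonneg B.σ≤τ B′.σ≤τ))
      (≤-reflexive (solve 4 (λ σ τ σ′ τ′ →
        (τ :+ σ) :* (τ′ :+ σ′) :+ (τ :- σ) :* (τ′ :- σ′)
          := σ :* σ′ :+ τ :* τ′ :+ (σ :* σ′ :+ τ :* τ′)) refl σ τ σ′ τ′)))
    expand : ∀ σ τ σ′ τ′ → 1# + (σ + σ′) - (τ + τ′) * (τ + τ′)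
      + (σ * σ′ + τ * τ′ + τ * τ′ * (1# - ((τ + τ′) + (τ + τ′)) + τ + τ′)
          + (τ - σ) * (τ′ * τ′) + τ * τ * (τ′ - σ′) + τ * τ * (τ′ * τ′))
      ≈ (1# + σ - τ * τ) * (1# + σ′ - τ′ * τ′)
    expand = solve 4 (λ σ τ σ′ τ′ → :1 :+ (σ :+ σ′) :- (τ :+ τ′) :* (τ :+ τ′)
      :+ (σ :* σ′ :+ τ :* τ′ :+ τ :* τ′ :* (:1 :- ((τ :+ τ′) :+ (τ :+ τ′)) :+ τ :+ τ′)
          :+ (τ :- σ) :* (τ′ :* τ′) :+ τ :* τ :* (τ′ :- σ′) :+ τ :* τ :* (τ′ :* τ′))
      := (:1 :+ σ :- τ :* τ) :* (:1 :+ σ′ :- τ′ :* τ′)) refl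
    0≤bound′ : 0# ≤ 1# + σ′ - τ′ * τ′
    0≤bound′ = ≤-trans
      (+-nonneg B′.-τ≤σ (+-nonneg (+-nonneg 0≤slack (+-nonneg B.0≤τ B.0≤τ))
        (*-nonneg B′.0≤τ (+-nonneg (+-nonneg 0≤slack (+-nonneg B.0≤τ B.0≤τ)) B′.0≤τ))))
      (≤-reflexive (solve 3 (λ τ σ′ τ′ →
        (τ′ :+ σ′) :+ (:1 :- ((τ :+ τ′) :+ (τ :+ τ′)) :+ (τ :+ τ)
          :+ τ′ :* (:1 :- ((τ :+ τ′) :+ (τ :+ τ′)) :+ (τ :+ τ) :+ τ′))
        := :1 :+ σ′ :- τ′ :* τ′) refl τ σ′ τ′))

  firstOrderBound-product : {P σ : Vector Carrier n} → 0# ≤ τ →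
    (∀ j → FirstOrderBound (P j) (σ j) τ) →
    n times τ + n times τ ≤ 1# → FirstOrderBound (product P) (sum σ) (n times τ)
  firstOrderBound-product {n = zero} 0≤τ B small = record
    { nonneg = 0≤1
    ; bound  = ≤-reflexive (solve 0 (:1 :+ :0 :- :0 :* :0 := :1) refl)
    ; -τ≤σ   = ≤-reflexive (solve 0 (:0 := :0 :+ :0) refl)
    ; σ≤τ    = ≤-reflexive (solve 0 (:0 := :0 :- :0) refl)
    }
  firstOrderBound-product {n = suc n} {τ = τ} 0≤τ B small =
    firstOrderBound-* (B zero) (firstOrderBound-product 0≤τ (B ∘ suc) smaller) small
    where
    smaller : n times τ + n times τ ≤ 1#
    smaller = ≤-trans (≤-by-difference (+-nonneg 0≤τ 0≤τ)
      (solve 2 (λ τ t → t :+ t :+ (τ :+ τ) := τ :+ t :+ (τ :+ t)) refl τ (n times τ))) small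

  -- A multiplicative form of P ≤ 1/(1 - κ), void for κ ≥ 1.
  record ReciprocalBound (P κ : Carrier) : Set ℓ₂ where
    field
      nonneg : 0# ≤ P
      0≤κ    : 0# ≤ κ
      bound  : P * (1# - κ) ≤ 1#

  -- Rests on 1 - (κ + κ′) ≤ (1 - κ)(1 - κ′). Replacing P(1 - κ) by 1 requires 1 - κ′ to be
  -- nonnegative, hence the case distinction; if κ + κ′ ≥ 1, the left side is at most 0.
  reciprocalBound-* : ReciprocalBound P κ → ReciprocalBound P′ κ′ → ReciprocalBound (P * P′) (κ + κ′)
  reciprocalBound-* {P} {κ} {P′} {κ′} B B′ = record
    { nonneg = 0≤PP′
    ; 0≤κ    = +-nonneg B.0≤κ B′.0≤κ
    ; bound  = ≤-cases 1# (κ + κ′) large small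
    }
    where
    module B = ReciprocalBound B
    module B′ = ReciprocalBound B′
    0≤PP′ = *-nonneg B.nonneg B′.nonneg
    large : 1# ≤ κ + κ′ → P * P′ * (1# - (κ + κ′)) ≤ 1#
    large 1≤κ+κ′ = ≤-by-difference (+-nonneg 0≤1 (*-nonneg 0≤PP′ (x≤y⇒0≤y-x 1≤κ+κ′)))
      (solve 2 (λ p k → p :* (:1 :- k) :+ (:1 :+ p :* (k :- :1)) := :1) refl (P * P′) (κ + κ′))
    small : κ + κ′ < 1# → P * P′ * (1# - (κ + κ′)) ≤ 1#
    small κ+κ′<1 = begin
      P * P′ * (1# - (κ + κ′))
        ≤⟨ ≤-by-difference (*-nonneg 0≤PP′ (*-nonneg B.0≤κ B′.0≤κ))
             (solve 4 (λ p k p′ k′ → p :* p′ :* (:1 :- (k :+ k′)) :+ p :* p′ :* (k :* k′)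
               := p :* (:1 :- k) :* (p′ :* (:1 :- k′))) refl P κ P′ κ′) ⟩
      P * (1# - κ) * (P′ * (1# - κ′))
        ≤⟨ *-monoʳ-≤ (*-nonneg B′.nonneg (x≤y⇒0≤y-x κ′≤1)) B.bound ⟩
      1# * (P′ * (1# - κ′))
        ≈⟨ *-identityˡ _ ⟩
      P′ * (1# - κ′)
        ≤⟨ B′.bound ⟩
      1#  ∎
      where
      κ′≤1 : κ′ ≤ 1#
      κ′≤1 = ≤-trans (≤-by-difference B.0≤κ (+-comm κ′ κ)) (<⇒≤ κ+κ′<1)

  reciprocalBound-1 : ReciprocalBound 1# 0#
  reciprocalBound-1 = record
    { nonneg = 0≤1
    ; 0≤κ    = ≤-refl
    ; bound  = ≤-reflexive (solve 0 (:1 :* (:1 :- :0) := :1) refl)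
    }

  reciprocalBound-1+u : 0# ≤ u → ReciprocalBound (1# + u) u
  reciprocalBound-1+u {u} 0≤u = record
    { nonneg = +-nonneg 0≤1 0≤u
    ; 0≤κ    = 0≤u
    ; bound  = ≤-by-difference (²-nonneg u) (solve 1 (λ u → (:1 :+ u) :* (:1 :- u) :+ u :* u := :1) refl u)
    }

  reciprocalBound-product : {P κ : Vector Carrier n} →
    (∀ j → ReciprocalBound (P j) (κ j)) → ReciprocalBound (product P) (sum κ)
  reciprocalBound-product {n = zero}  B = reciprocalBound-1
  reciprocalBound-product {n = suc n} B = reciprocalBound-* (B zero) (reciprocalBound-product (B ∘ suc))

  reciprocalBound-^ : ∀ k → ReciprocalBound P κ → ReciprocalBound (P ^ k) (k times κ)
  reciprocalBound-^ zero    B = reciprocalBound-1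
  reciprocalBound-^ (suc k) B = reciprocalBound-* B (reciprocalBound-^ k B)

  -- Twice the expectation of (1 + yε)^n for a Rademacher variable ε, the
  -- substitute for 2 cosh(ny).
  signSum : ℕ → Carrier → Carrier
  signSum n y = (1# + y) ^ n + (1# - y) ^ n

  -- The substitute for 2y sinh(ny). The extra factor y gives a joint recursion with `signSum` whose
  -- coefficients 1 and y² are nonnegative, so that both stay nonnegative whatever the sign of y.
  signDifference : ℕ → Carrier → Carrier
  signDifference n y = y * ((1# + y) ^ n - (1# - y) ^ n)

  signSum-suc : ∀ n y → signSum (suc n) y ≈ signSum n y + signDifference n y
  signSum-suc n y = solve 3 (λ y p q → (:1 :+ y) :* p :+ (:1 :- y) :* q := p :+ q :+ y :* (p :- q)) refl
    y ((1# + y) ^ n) ((1# - y) ^ n)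

  signDifference-suc : ∀ n y → signDifference (suc n) y ≈ signDifference n y + y * y * signSum n y
  signDifference-suc n y = solve 3 (λ y p q → y :* ((:1 :+ y) :* p :- (:1 :- y) :* q) := y :* (p :- q) :+ y :* y :* (p :+ q)) refl
    y ((1# + y) ^ n) ((1# - y) ^ n)

  signDifference-nonneg : ∀ n y → 0# ≤ signDifference n y
  signSum-nonneg : ∀ n y → 0# ≤ signSum n y
  signDifference-nonneg zero    y = ≤-reflexive (solve 1 (λ y → :0 := y :* (:1 :- :1)) refl y)
  signDifference-nonneg (suc n) y = ≤-trans
    (+-nonneg (signDifference-nonneg n y) (*-nonneg (²-nonneg y) (signSum-nonneg n y)))
    (≤-reflexive (sym (signDifference-suc n y)))
  signSum-nonneg zero    y = +-nonneg 0≤1 0≤1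
  signSum-nonneg (suc n) y = ≤-trans
    (+-nonneg (signSum-nonneg n y) (signDifference-nonneg n y))
    (≤-reflexive (sym (signSum-suc n y)))

  -- The analogue of tanh x ≤ x. The induction works because `signSum` does not decrease in n.
  signDifference≤ : ∀ n y → signDifference n y ≤ fromℕ n * (y * y) * signSum n y
  signDifference≤ zero    y = ≤-reflexive
    (solve 1 (λ y → y :* (:1 :- :1) := :0 :* (y :* y) :* (:1 :+ :1)) refl y)
  signDifference≤ (suc n) y = begin
    signDifference (suc n) y
      ≈⟨ signDifference-suc n y ⟩
    signDifference n y + y * y * signSum n y
      ≤⟨ +-monoˡ-≤ _ (signDifference≤ n y) ⟩
    fromℕ n * (y * y) * signSum n y + y * y * signSum n y
      ≈⟨ solve 3 (λ n u g → n :* u :* g :+ u :* g := (:1 :+ n) :* u :* g) refl (fromℕ n) (y * y) (signSum n y) ⟩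
    fromℕ (suc n) * (y * y) * signSum n y
      ≤⟨ *-monoˡ-≤ (*-nonneg (fromℕ-nonneg (suc n)) (²-nonneg y))
           (≤-by-difference (signDifference-nonneg n y) (sym (signSum-suc n y))) ⟩
    fromℕ (suc n) * (y * y) * signSum (suc n) y  ∎

  -- The number n(n - 1)/2 without a division: the total of the exponents 0, 1, ..., n - 1 collected
  -- in `signSum≤-triangular`.
  triangular : ℕ → ℕ
  triangular zero    = zero
  triangular (suc n) = n ℕ.+ triangular n

  -- Used to round the exponent up to 2m · m, a multiple of m, from which an m-th power can be drawn
  -- later.
  triangular-even : ∀ m → triangular (m ℕ.+ m) ℕ.+ m ≡ (m ℕ.+ m) ℕ.* m
  triangular-even zero    = ≡.refl
  triangular-even (suc m) rewrite ℕ.+-suc m m = ≡.trans (rearrange m (triangular (m ℕ.+ m)))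
    (≡.trans (≡.cong (ℕ._+ (2 ℕ.+ 4 ℕ.* m)) (triangular-even m)) (expand m))
    where
    rearrange : ∀ m t → suc (m ℕ.+ m) ℕ.+ (m ℕ.+ m ℕ.+ t) ℕ.+ suc m ≡ t ℕ.+ m ℕ.+ (2 ℕ.+ 4 ℕ.* m)
    rearrange = solve-∀
    expand : ∀ m → (m ℕ.+ m) ℕ.* m ℕ.+ (2 ℕ.+ 4 ℕ.* m) ≡ suc (suc (m ℕ.+ m)) ℕ.* suc m
    expand = solve-∀

  -- Step n multiplies `signSum` by at most 1 + ny², which Bernoulli's inequality turns into a power
  -- of 1 + y²; then only exponents have to be added.
  signSum≤-triangular : ∀ n y → signSum n y ≤ fromℕ 2 * (1# + y * y) ^ triangular n
  signSum≤-triangular zero    y = ≤-reflexive (solve 0 (:1 :+ :1 := :2 :* :1) refl)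
  signSum≤-triangular (suc n) y = begin
    signSum (suc n) y
      ≈⟨ signSum-suc n y ⟩
    signSum n y + signDifference n y
      ≤⟨ +-monoʳ-≤ _ (signDifference≤ n y) ⟩
    signSum n y + fromℕ n * (y * y) * signSum n y
      ≈⟨ solve 3 (λ n u g → g :+ n :* u :* g := (:1 :+ n :* u) :* g) refl (fromℕ n) (y * y) (signSum n y) ⟩
    (1# + fromℕ n * (y * y)) * signSum n y
      ≤⟨ *-mono-≤ (+-nonneg 0≤1 (*-nonneg (fromℕ-nonneg n) (²-nonneg y))) (signSum-nonneg n y)
           (bernoulli n (+-nonneg 0≤1 (²-nonneg y))) (signSum≤-triangular n y) ⟩
    (1# + y * y) ^ n * (fromℕ 2 * (1# + y * y) ^ triangular n)
      ≈⟨ solve 3 (λ p t q → p :* (t :* q) := t :* (p :* q)) refl _ (fromℕ 2) _ ⟩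
    fromℕ 2 * ((1# + y * y) ^ n * (1# + y * y) ^ triangular n)
      ≈⟨ *-congˡ (^-homo-* (1# + y * y) n (triangular n)) ⟨
    fromℕ 2 * (1# + y * y) ^ (n ℕ.+ triangular n)  ∎

  -- The analogue of cosh x ≤ exp(x²/2).
  signSum≤ : ∀ m y → signSum (m ℕ.+ m) y ≤ fromℕ 2 * (1# + y * y) ^ ((m ℕ.+ m) ℕ.* m)
  signSum≤ m y = ≤-trans (signSum≤-triangular (m ℕ.+ m) y) (*-monoˡ-≤ (fromℕ-nonneg 2)
    (^-monoʳ-≤ (≤-by-difference (²-nonneg y) refl)
      (ℕ.≤-trans (ℕ.m≤m+n _ m) (ℕ.≤-reflexive (triangular-even m)))))

-- Expectations as unnormalised sums over sign vectors.

module RademacherSums {c ℓ₁ ℓ₂} (ℝ : RealNumbers c ℓ₁ ℓ₂) where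
  open RealNumbers ℝ hiding (zero)
  open OrderedField ℝ
  open ProductEstimates ℝ
  open DiagonalEstimation ℝ
  open ≤-Reasoning
  open SumProperties (CommutativeRing.semiring commutativeRing)
    using (sum-cong-≋; ∑-distrib-+; *-distribˡ-sum)
  open MultProperties (CommutativeRing.semiring commutativeRing) using (×1-homo-*)

  private variable
    p q : Level
    X : Set p
    Y : Set q
    n s : ℕ

  sumOver : List X → (X → Carrier) → Carrier
  sumOver []       f = 0#
  sumOver (x ∷ xs) f = f x + sumOver xs f

  sumOver-cong : ∀ (xs : List X) {f g} → (∀ x → f x ≈ g x) → sumOver xs f ≈ sumOver xs g
  sumOver-cong []       f≈g = refl
  sumOver-cong (x ∷ xs) f≈g = +-cong (f≈g x) (sumOver-cong xs f≈g)

  sumOver-mono-≤ : ∀ (xs : List X) {f g} → (∀ x → f x ≤ g x) → sumOver xs f ≤ sumOver xs g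
  sumOver-mono-≤ []       f≤g = ≤-refl
  sumOver-mono-≤ (x ∷ xs) f≤g = +-mono-≤ (f≤g x) (sumOver-mono-≤ xs f≤g)

  sumOver-nonneg : ∀ (xs : List X) {f} → (∀ x → 0# ≤ f x) → 0# ≤ sumOver xs f
  sumOver-nonneg []       0≤f = ≤-refl
  sumOver-nonneg (x ∷ xs) 0≤f = +-nonneg (0≤f x) (sumOver-nonneg xs 0≤f)

  sumOver-+ : ∀ (xs : List X) f g → sumOver xs (λ x → f x + g x) ≈ sumOver xs f + sumOver xs g
  sumOver-+ []       f g = sym (+-identityʳ 0#)
  sumOver-+ (x ∷ xs) f g = trans (+-congˡ (sumOver-+ xs f g))
    (solve 4 (λ a b c d → a :+ b :+ (c :+ d) := a :+ c :+ (b :+ d)) refl (f x) (g x) (sumOver xs f) (sumOver xs g))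

  sumOver-*ʳ : ∀ (xs : List X) f a → sumOver xs (λ x → f x * a) ≈ sumOver xs f * a
  sumOver-*ʳ []       f a = sym (zeroˡ a)
  sumOver-*ʳ (x ∷ xs) f a = trans (+-congˡ (sumOver-*ʳ xs f a)) (sym (distribʳ a (f x) (sumOver xs f)))

  sumOver-*ˡ : ∀ (xs : List X) a f → sumOver xs (λ x → a * f x) ≈ a * sumOver xs f
  sumOver-*ˡ xs a f = trans (sumOver-cong xs (λ x → *-comm a (f x)))
    (trans (sumOver-*ʳ xs f a) (*-comm _ a))

  sumOver-++ : ∀ (xs ys : List X) f → sumOver (xs ++ ys) f ≈ sumOver xs f + sumOver ys f
  sumOver-++ []       ys f = sym (+-identityˡ _)
  sumOver-++ (x ∷ xs) ys f = trans (+-congˡ (sumOver-++ xs ys f)) (sym (+-assoc _ _ _))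

  sumOver-map : ∀ (h : X → Y) xs f → sumOver (map h xs) f ≈ sumOver xs (f ∘ h)
  sumOver-map h []       f = refl
  sumOver-map h (x ∷ xs) f = +-congˡ (sumOver-map h xs f)

  sumOver-vectors-suc : ∀ (xs : List X) n f →
    sumOver (vectorsOver xs (suc n)) f ≈ sumOver xs (λ x → sumOver (vectorsOver xs n) (λ v → f (x ∷ v)))
  sumOver-vectors-suc {X = X} xs n f = product-rule xs
    where
    vs = vectorsOver xs n
    product-rule : ∀ ys → sumOver (cartesianProductWith _∷_ ys vs) f ≈ sumOver ys (λ x → sumOver vs (λ v → f (x ∷ v)))
    product-rule []       = refl
    product-rule (y ∷ ys) = trans (sumOver-++ (map (y ∷_) vs) (cartesianProductWith _∷_ ys vs) f)
      (+-cong (sumOver-map (y ∷_) vs f) (product-rule ys))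

  -- Independence of identically distributed coordinates; applied to the s queries.
  sumOver-vectors-product : ∀ (xs : List X) n (h : X → Carrier) →
    sumOver (vectorsOver xs n) (λ v → product (λ k → h (lookup v k))) ≈ sumOver xs h ^ n
  sumOver-vectors-product xs zero    h = +-identityʳ 1#
  sumOver-vectors-product xs (suc n) h = begin-equality
    sumOver (vectorsOver xs (suc n)) (λ v → product (λ k → h (lookup v k)))
      ≈⟨ sumOver-vectors-suc xs n _ ⟩
    sumOver xs (λ x → sumOver vs (λ v → h x * H v))
      ≈⟨ sumOver-cong xs (λ x → sumOver-*ˡ vs (h x) H) ⟩
    sumOver xs (λ x → h x * sumOver vs H)
      ≈⟨ sumOver-*ʳ xs h (sumOver vs H) ⟩
    sumOver xs h * sumOver vs H
      ≈⟨ *-congˡ (sumOver-vectors-product xs n h) ⟩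
    sumOver xs h * sumOver xs h ^ n  ∎
    where
    vs = vectorsOver xs n
    H : Vec _ n → Carrier
    H v = product (λ k → h (lookup v k))

  sumOver-vectors-1 : ∀ (xs : List X) n → sumOver (vectorsOver xs n) (const 1#) ≈ sumOver xs (const 1#) ^ n
  sumOver-vectors-1 xs n = trans
    (sumOver-cong (vectorsOver xs n) (λ _ → sym (product-1 n)))
    (sumOver-vectors-product xs n (const 1#))
    where
    product-1 : ∀ n → product {n} (const 1#) ≈ 1#
    product-1 zero    = refl
    product-1 (suc n) = trans (*-identityˡ _) (product-1 n)

  signs : List Sign
  signs = Sign.+ ∷ Sign.- ∷ []

  fromℕ-^ : ∀ b n → fromℕ (b ℕ.^ n) ≈ fromℕ b ^ n
  fromℕ-^ b zero    = +-identityʳ 1#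
  fromℕ-^ b (suc n) = trans (×1-homo-* b (b ℕ.^ n)) (*-congˡ (fromℕ-^ b n))

  indicator : Bool → Carrier
  indicator true  = 1#
  indicator false = 0#

  count≈sumOver : ∀ (D : X → Bool) xs → fromℕ (length (filterᵇ D xs)) ≈ sumOver xs (indicator ∘ D)
  count≈sumOver D []       = refl
  count≈sumOver D (x ∷ xs) with D x
  ... | true  = +-congˡ (count≈sumOver D xs)
  ... | false = trans (count≈sumOver D xs) (sym (+-identityˡ _))

  fromℕ-2^[s*n] : ∀ s n → fromℕ (2 ℕ.^ (s ℕ.* n)) ≈ (fromℕ 2 ^ n) ^ s
  fromℕ-2^[s*n] s n = begin-equality
    fromℕ (2 ℕ.^ (s ℕ.* n))    ≈⟨ fromℕ-^ 2 (s ℕ.* n) ⟩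
    fromℕ 2 ^ (s ℕ.* n)        ≡⟨ ≡.cong (fromℕ 2 ^_) (ℕ.*-comm n s) ⟨
    fromℕ 2 ^ (n ℕ.* s)        ≈⟨ ^-assocʳ (fromℕ 2) n s ⟨
    (fromℕ 2 ^ n) ^ s          ∎

  sumOver-outcomes-1 : ∀ s n → sumOver (outcomes s n) (const 1#) ≈ (fromℕ 2 ^ n) ^ s
  sumOver-outcomes-1 s n =
    trans (sumOver-vectors-1 (vectorsOver signs n) s) (^-congˡ s (sumOver-vectors-1 signs n))

  factor : Carrier → Sign → Sign → Carrier
  factor y e σ = 1# + y * (⟦ e ⟧ * ⟦ σ ⟧)

  -- Multiplying by a fixed sign e at most swaps the two outcomes.
  sumOver-factor : ∀ N y e → sumOver signs (λ σ → factor y e σ ^ N) ≈ signSum N y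
  sumOver-factor N y Sign.+ = trans (+-congˡ (+-identityʳ _)) (+-cong
    (^-congˡ N (solve 1 (λ y → :1 :+ y :* (:1 :* :1) := :1 :+ y) refl y))
    (^-congˡ N (solve 1 (λ y → :1 :+ y :* (:1 :* :- :1) := :1 :- y) refl y)))
  sumOver-factor N y Sign.- = trans (+-congˡ (+-identityʳ _)) (trans (+-comm _ _) (+-cong
    (^-congˡ N (solve 1 (λ y → :1 :+ y :* (:- :1 :* :- :1) := :1 :+ y) refl y))
    (^-congˡ N (solve 1 (λ y → :1 :+ y :* (:- :1 :* :1) := :1 :- y) refl y))))

  -- On the diagonal the product of the signs is always 1, so both summands come from 1 + y. As y
  -- vanishes there, one of them may be turned into 1 - y, and the index i gets the same factor as
  -- all others.
  sumOver-diagonal : ∀ N y → y ≈ 0# → ∀ a → sumOver signs (λ e → factor y e e ^ N * a) ≈ signSum N y * a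
  sumOver-diagonal N y y≈0 a = trans (sumOver-*ʳ signs (λ e → factor y e e ^ N) a) (*-congʳ
    (trans (+-congˡ (+-identityʳ _)) (+-cong
      (^-congˡ N (solve 1 (λ y → :1 :+ y :* (:1 :* :1) := :1 :+ y) refl y))
      (^-congˡ N (trans (solve 1 (λ y → :1 :+ y :* (:- :1 :* :- :1) := :1 :- y :+ (y :+ y)) refl y)
        (trans (+-congˡ (+-cong y≈0 y≈0)) (solve 1 (λ x → x :+ (:0 :+ :0) := x) refl (1# - y))))))))

  rowProduct : ℕ → Vector Carrier n → Sign → Vec Sign n → Carrier
  rowProduct N y e v = product (λ j → factor (y j) e (lookup v j) ^ N)

  sumOver-rowProduct-fixed : ∀ {n} N (y : Vector Carrier n) e →
    sumOver (vectorsOver signs n) (rowProduct N y e) ≈ product (λ j → signSum N (y j))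
  sumOver-rowProduct-fixed {zero}  N y e = +-identityʳ 1#
  sumOver-rowProduct-fixed {suc n} N y e = begin-equality
    sumOver (vectorsOver signs (suc n)) (rowProduct N y e)
      ≈⟨ sumOver-vectors-suc signs n _ ⟩
    sumOver signs (λ σ → sumOver vs (λ v → factor (y zero) e σ ^ N * rowProduct N (y ∘ suc) e v))
      ≈⟨ sumOver-cong signs (λ σ → trans (sumOver-*ˡ vs (factor (y zero) e σ ^ N) (rowProduct N (y ∘ suc) e))
           (*-congˡ (sumOver-rowProduct-fixed N (y ∘ suc) e))) ⟩
    sumOver signs (λ σ → factor (y zero) e σ ^ N * product (λ j → signSum N (y (suc j))))
      ≈⟨ sumOver-*ʳ signs (λ σ → factor (y zero) e σ ^ N) _ ⟩
    sumOver signs (λ σ → factor (y zero) e σ ^ N) * product (λ j → signSum N (y (suc j)))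
      ≈⟨ *-congʳ (sumOver-factor N (y zero) e) ⟩
    signSum N (y zero) * product (λ j → signSum N (y (suc j)))  ∎
    where vs = vectorsOver signs n

  -- All factors share the random sign at i. Once it is fixed, the sum over the other signs does not
  -- depend on it, so its products with them behave like independent Rademacher variables.
  sumOver-rowProduct : ∀ {n} N (y : Vector Carrier n) i → y i ≈ 0# →
    sumOver (vectorsOver signs n) (λ v → rowProduct N y (lookup v i) v) ≈ product (λ j → signSum N (y j))
  sumOver-rowProduct {suc n} N y zero y₀≈0 = begin-equality
    sumOver (vectorsOver signs (suc n)) (λ v → rowProduct N y (lookup v zero) v)
      ≈⟨ sumOver-vectors-suc signs n _ ⟩
    sumOver signs (λ σ → sumOver vs (λ v → factor (y zero) σ σ ^ N * rowProduct N (y ∘ suc) σ v))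
      ≈⟨ sumOver-cong signs (λ σ → trans (sumOver-*ˡ vs (factor (y zero) σ σ ^ N) (rowProduct N (y ∘ suc) σ))
           (*-congˡ (sumOver-rowProduct-fixed N (y ∘ suc) σ))) ⟩
    sumOver signs (λ σ → factor (y zero) σ σ ^ N * product (λ j → signSum N (y (suc j))))
      ≈⟨ sumOver-diagonal N (y zero) y₀≈0 _ ⟩
    signSum N (y zero) * product (λ j → signSum N (y (suc j)))  ∎
    where vs = vectorsOver signs n
  -- The shared sign lies in the tail, so the two-term sum over the first sign is moved inside the
  -- sum over tails.
  sumOver-rowProduct {suc n} N y (suc i) yᵢ≈0 = begin-equality
    sumOver (vectorsOver signs (suc n)) (λ v → rowProduct N y (lookup v (suc i)) v)
      ≈⟨ sumOver-vectors-suc signs n _ ⟩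
    sumOver signs (λ σ → sumOver vs (λ v → factor (y zero) (lookup v i) σ ^ N * R v))
      ≈⟨ +-congˡ (+-identityʳ _) ⟩
    sumOver vs (λ v → factor (y zero) (lookup v i) Sign.+ ^ N * R v) + sumOver vs (λ v → factor (y zero) (lookup v i) Sign.- ^ N * R v)
      ≈⟨ sumOver-+ vs _ _ ⟨
    sumOver vs (λ v → factor (y zero) (lookup v i) Sign.+ ^ N * R v + factor (y zero) (lookup v i) Sign.- ^ N * R v)
      ≈⟨ sumOver-cong vs (λ v → trans
           (solve 3 (λ a b r → a :* r :+ b :* r := (a :+ (b :+ :0)) :* r) refl
              (factor (y zero) (lookup v i) Sign.+ ^ N) (factor (y zero) (lookup v i) Sign.- ^ N) (R v))
           (*-congʳ (sumOver-factor N (y zero) (lookup v i)))) ⟩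
    sumOver vs (λ v → signSum N (y zero) * R v)
      ≈⟨ sumOver-*ˡ vs (signSum N (y zero)) R ⟩
    signSum N (y zero) * sumOver vs R
      ≈⟨ *-congˡ (sumOver-rowProduct N (y ∘ suc) i yᵢ≈0) ⟩
    signSum N (y zero) * product (λ j → signSum N (y (suc j)))  ∎
    where
    vs = vectorsOver signs n
    R : Vec Sign n → Carrier
    R v = rowProduct N (y ∘ suc) (lookup v i) v

  offDiagonal : Fin n → Vector Carrier n → Vector Carrier n
  offDiagonal i x = updateAt x i (const 0#)

  offDiagonal-i : ∀ (i : Fin n) x → offDiagonal i x i ≈ 0#
  offDiagonal-i zero    x = refl
  offDiagonal-i (suc i) x = offDiagonal-i i (x ∘ suc)

  -- A general `F` lets this serve both the matrix-vector product and the squared norm.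
  sum-offDiagonal : ∀ (i : Fin n) (F : Fin n → Carrier → Carrier) x → F i 0# ≈ 0# →
    sum (λ j → F j (x j)) ≈ F i (x i) + sum (λ j → F j (offDiagonal i x j))
  sum-offDiagonal zero F x F0≈0 = +-congˡ (sym (trans (+-congʳ F0≈0) (+-identityˡ _)))
  sum-offDiagonal (suc i) F x F0≈0 = trans (+-congˡ (sum-offDiagonal i (F ∘ suc) (x ∘ suc) F0≈0))
    (solve 3 (λ a b c → a :+ (b :+ c) := b :+ (a :+ c)) refl _ _ _)

  -- s times the deviation of the estimator of the i-th diagonal entry from
  -- its mean, where b is the i-th row without its diagonal entry.
  deviation : Vector Carrier n → Fin n → Ω s n → Carrier
  deviation b i ω = sum λ k → sum λ j → b j * (query ω k i * query ω k j)

  ⟦σ⟧²≈1 : ∀ σ → ⟦ σ ⟧ * ⟦ σ ⟧ ≈ 1#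
  ⟦σ⟧²≈1 Sign.+ = *-identityˡ 1#
  ⟦σ⟧²≈1 Sign.- = solve 0 (:- :1 :* :- :1 := :1) refl

  sum-const : ∀ n a → sum {n} (const a) ≈ fromℕ n * a
  sum-const zero    a = sym (zeroˡ a)
  sum-const (suc n) a = trans (+-congˡ (sum-const n a))
    (solve 2 (λ n a → a :+ n :* a := (:1 :+ n) :* a) refl (fromℕ n) a)

  -- The square of a sign is 1, so the diagonal entry appears free of randomness.
  query-entry : ∀ (A : Matrix n) i (ω : Ω s n) k →
    (query ω k ⊙ (A ·ᵥ query ω k)) i ≈ A i i + sum (λ j → offDiagonal i (A i) j * (query ω k i * query ω k j))
  query-entry A i ω k = begin-equality
    v i * sum (λ j → A i j * v j)
      ≈⟨ *-distribˡ-sum (v i) (λ j → A i j * v j) ⟩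
    sum (λ j → v i * (A i j * v j))
      ≈⟨ sum-cong-≋ (λ j → solve 3 (λ x a y → x :* (a :* y) := a :* (x :* y)) refl (v i) (A i j) (v j)) ⟩
    sum (λ j → A i j * (v i * v j))
      ≈⟨ sum-offDiagonal i (λ j a → a * (v i * v j)) (A i) (zeroˡ _) ⟩
    A i i * (v i * v i) + sum (λ j → offDiagonal i (A i) j * (v i * v j))
      ≈⟨ +-congʳ (trans (*-congˡ (⟦σ⟧²≈1 (lookup (lookup ω k) i))) (*-identityʳ _)) ⟩
    A i i + sum (λ j → offDiagonal i (A i) j * (v i * v j))  ∎
    where v = query ω k

  estimator-deviation : .{{_ : NonZero s}} → ∀ (A : Matrix n) i (ω : Ω s n) →
    fromℕ s * (rademacherEstimator A ω i - A i i) ≈ deviation (offDiagonal i (A i)) i ω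
  estimator-deviation {s = s} A i ω = begin-equality
    fromℕ s * (Q * r - A i i)
      ≈⟨ solve 4 (λ s q r a → s :* (q :* r :- a) := q :* (s :* r) :- s :* a) refl (fromℕ s) Q r (A i i) ⟩
    Q * (fromℕ s * r) - fromℕ s * A i i
      ≈⟨ +-congʳ (*-congˡ (*-inverseʳ (fromℕ#0 s))) ⟩
    Q * 1# - fromℕ s * A i i
      ≈⟨ +-congʳ (*-congʳ (trans (sum-cong-≋ (query-entry A i ω))
           (trans (∑-distrib-+ (λ _ → A i i) S) (+-congʳ (sum-const s (A i i)))))) ⟩
    (fromℕ s * A i i + sum S) * 1# - fromℕ s * A i i
      ≈⟨ solve 2 (λ a S → (a :+ S) :* :1 :- a := S) refl (fromℕ s * A i i) (sum S) ⟩
    sum S  ∎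
    where
    r = fromℕ s ⁻¹[ fromℕ#0 s ]
    Q = sum (λ k → (query ω k ⊙ (A ·ᵥ query ω k)) i)
    S : Fin s → Carrier
    S k = sum (λ j → offDiagonal i (A i) j * (query ω k i * query ω k j))

  sum-offDiagonal-² : ∀ i (x : Vector Carrier n) → sum (λ j → offDiagonal i x j * offDiagonal i x j) ≈ ∥ x ∥₂² - x i ²
  sum-offDiagonal-² i x = begin-equality
    sum (λ j → offDiagonal i x j * offDiagonal i x j)
      ≈⟨ solve 2 (λ a b → a := b :+ a :- b) refl _ (x i * x i) ⟩
    x i * x i + sum (λ j → offDiagonal i x j * offDiagonal i x j) - x i * x i
      ≈⟨ +-congʳ (sum-offDiagonal i (λ j a → a * a) x (zeroˡ 0#)) ⟨
    ∥ x ∥₂² - x i ²  ∎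

-- The exponential moment bound for one tail.

module ChernoffBound {c ℓ₁ ℓ₂} (ℝ : RealNumbers c ℓ₁ ℓ₂) where
  open RealNumbers ℝ hiding (zero)
  open OrderedField ℝ
  open ExponentialSeries ℝ
  open ProductEstimates ℝ
  open DiagonalEstimation ℝ
  open RademacherSums ℝ
  open ≤-Reasoning
  open SumProperties (CommutativeRing.semiring commutativeRing)
    using (sum-cong-≋; *-distribˡ-sum)
  open MultProperties (CommutativeRing.semiring commutativeRing) using (×-homo-+)

  ∥∥₂²-nonneg : ∀ {n} (x : Vector Carrier n) → 0# ≤ ∥ x ∥₂²
  ∥∥₂²-nonneg {zero}  x = ≤-refl
  ∥∥₂²-nonneg {suc n} x = +-nonneg (²-nonneg (x zero)) (∥∥₂²-nonneg (x ∘ suc))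

  square≤sum-of-squares : ∀ {n} (x : Vector Carrier n) j → x j * x j ≤ ∥ x ∥₂²
  square≤sum-of-squares x zero    = ≤-by-difference (∥∥₂²-nonneg (x ∘ suc)) refl
  square≤sum-of-squares x (suc j) = ≤-trans (square≤sum-of-squares (x ∘ suc) j)
    (≤-by-difference (²-nonneg (x zero)) (+-comm _ _))

  -- Bounds each |b j| by 1 + v without a square root. The crudeness is harmless, since it affects
  -- only errors that vanish as m grows.
  x≤1+x² : ∀ x → x ≤ 1# + x * x
  x≤1+x² x = ≤-by-difference
    (0≤x+x⇒0≤x (≤-trans (+-nonneg (+-nonneg 0≤1 (²-nonneg x)) (²-nonneg (1# - x)))
      (≤-reflexive (solve 1 (λ x → :1 :+ x :* x :+ (:1 :- x) :* (:1 :- x)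
        := (:1 :+ x :* x :- x) :+ (:1 :+ x :* x :- x)) refl x))))
    (solve 1 (λ x → x :+ (:1 :+ x :* x :- x) := :1 :+ x :* x) refl x)

  times≈* : ∀ n x → n times x ≈ fromℕ n * x
  times≈* zero    x = sym (zeroˡ x)
  times≈* (suc n) x = trans (+-congˡ (times≈* n x))
    (solve 2 (λ n x → x :+ n :* x := (:1 :+ n) :* x) refl (fromℕ n) x)

  sign-product : ∀ e σ → ⟦ e ⟧ * ⟦ σ ⟧ ≈ 1# ⊎ ⟦ e ⟧ * ⟦ σ ⟧ ≈ - 1#
  sign-product Sign.+ Sign.+ = inj₁ (*-identityˡ 1#)
  sign-product Sign.+ Sign.- = inj₂ (*-identityˡ (- 1#))
  sign-product Sign.- Sign.+ = inj₂ (*-identityʳ (- 1#))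
  sign-product Sign.- Sign.- = inj₁ (⟦σ⟧²≈1 Sign.-)

  fromℕ-+ : ∀ m n → fromℕ (m ℕ.+ n) ≈ fromℕ m + fromℕ n
  fromℕ-+ = ×-homo-+ 1#

  -- A one-sided tail bound for the deviation. The weight approximates
  -- exp(2r · deviation - L - B), where L + B is the bound on 2r · deviation and
  -- B bounds the logarithm of the expectation of exp(2r · deviation); m counts
  -- the steps in the approximation of exp x by (1 + x/m)^m, and μ = 1/m.
  module UpperTail {n} (s : ℕ) (i : Fin n) (b : Vector Carrier n) (bᵢ≈0 : b i ≈ 0#)
    (v : Carrier) (∥b∥²≈v : ∥ b ∥₂² ≈ v) (0≤v : 0# ≤ v)
    (L r : Carrier) (0≤L : 0# ≤ L) (0≤r : 0# ≤ r)
    where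

    -- G/m and H/m are the values of τ in `FirstOrderBound` for one entry and for all s · n entries
    -- together. In `C`, the summand x² is the loss in (1 + x/m)(1 - x/m), and 2H² is the loss from
    -- squaring the first-order bound.
    B G H x C : Carrier
    B = fromℕ 2 * (fromℕ s * (r * r * v))
    G = r * (1# + v)
    H = fromℕ s * (fromℕ n * G)
    x = L + B
    C = x * x + (H * H + H * H)

    0≤B : 0# ≤ B
    0≤B = *-nonneg (fromℕ-nonneg 2) (*-nonneg (fromℕ-nonneg s) (*-nonneg (²-nonneg r) 0≤v))

    0≤G : 0# ≤ G
    0≤G = *-nonneg 0≤r (+-nonneg 0≤1 0≤v)

    0≤H : 0# ≤ H
    0≤H = *-nonneg (fromℕ-nonneg s) (*-nonneg (fromℕ-nonneg n) 0≤G)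

    0≤x : 0# ≤ x
    0≤x = +-nonneg 0≤L 0≤B

    0≤C : 0# ≤ C
    0≤C = +-nonneg (²-nonneg x) (+-nonneg (²-nonneg H) (²-nonneg H))

    -- A sum of nonnegative quantities, so that the one condition `negligible * μ ≤ 1#` bounds x/m,
    -- G/m, 2H/m and C/m at once.
    negligible : Carrier
    negligible = x + G + (H + H) + C

    0≤negligible : 0# ≤ negligible
    0≤negligible = +-nonneg (+-nonneg (+-nonneg 0≤x 0≤G) (+-nonneg 0≤H 0≤H)) 0≤C

    module Step (m : ℕ) .{{_ : NonZero m}} (μ : Carrier) (0<μ : 0# < μ) (mμ≈1 : fromℕ m * μ ≈ 1#)
      (small : negligible * μ ≤ 1#)
      where

      0≤μ : 0# ≤ μ
      0≤μ = <⇒≤ 0<μ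

      z θ τ₁ τ : Carrier
      z = r * μ
      θ = x * μ
      τ₁ = z * (1# + v)
      τ = s times (n times τ₁)

      y : Vector Carrier n
      y j = z * b j

      0≤z : 0# ≤ z
      0≤z = *-nonneg 0≤r 0≤μ

      0≤τ₁ : 0# ≤ τ₁
      0≤τ₁ = *-nonneg 0≤z (+-nonneg 0≤1 0≤v)

      part-small : ∀ {a d} → 0# ≤ d → a + d ≈ negligible → a * μ ≤ 1#
      part-small 0≤d a+d≈ = ≤-trans (*-monoʳ-≤ 0≤μ (≤-by-difference 0≤d a+d≈)) small

      θ≤1 : θ ≤ 1#
      θ≤1 = part-small (+-nonneg (+-nonneg 0≤G (+-nonneg 0≤H 0≤H)) 0≤C)
        (solve 4 (λ x g h c → x :+ (g :+ h :+ c) := x :+ g :+ h :+ c) refl x G (H + H) C)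

      Lμ≤1 : L * μ ≤ 1#
      Lμ≤1 = ≤-trans (*-monoʳ-≤ 0≤μ (≤-by-difference 0≤B refl)) θ≤1

      Bμ≤1 : B * μ ≤ 1#
      Bμ≤1 = ≤-trans (*-monoʳ-≤ 0≤μ (≤-by-difference 0≤L (+-comm B L))) θ≤1

      Cμ≤1 : C * μ ≤ 1#
      Cμ≤1 = part-small (+-nonneg (+-nonneg 0≤x 0≤G) (+-nonneg 0≤H 0≤H)) (+-comm _ _)

      τ₁≤1 : τ₁ ≤ 1#
      τ₁≤1 = ≤-trans
        (≤-reflexive (solve 3 (λ r v μ → r :* μ :* (:1 :+ v) := r :* (:1 :+ v) :* μ) refl r v μ))
        (part-small (+-nonneg 0≤x (+-nonneg (+-nonneg 0≤H 0≤H) 0≤C))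
          (solve 4 (λ x g h c → g :+ (x :+ (h :+ c)) := x :+ g :+ h :+ c) refl x G (H + H) C))

      μ≤1 : μ ≤ 1#
      μ≤1 = begin
        μ              ≈⟨ *-identityˡ μ ⟨
        1# * μ         ≤⟨ *-monoʳ-≤ 0≤μ (1≤fromℕ m) ⟩
        fromℕ m * μ    ≈⟨ mμ≈1 ⟩
        1#             ∎
        where
        1≤fromℕ : ∀ k .{{_ : NonZero k}} → 1# ≤ fromℕ k
        1≤fromℕ (suc k) = ≤-by-difference (fromℕ-nonneg k) refl

      τ≈Hμ : τ ≈ H * μ
      τ≈Hμ = trans (times≈* s _) (trans (*-congˡ (times≈* n _))
        (solve 5 (λ s n r μ v → s :* (n :* (r :* μ :* (:1 :+ v))) := s :* (n :* (r :* (:1 :+ v))) :* μ) refl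
          (fromℕ s) (fromℕ n) r μ v))

      2τ≤1 : τ + τ ≤ 1#
      2τ≤1 = ≤-trans (≤-reflexive (trans (+-cong τ≈Hμ τ≈Hμ) (sym (distribʳ μ H H))))
        (part-small (+-nonneg (+-nonneg 0≤x 0≤G) 0≤C)
          (solve 4 (λ x g h c → h :+ (x :+ g :+ c) := x :+ g :+ h :+ c) refl x G (H + H) C))

      entry : Ω s n → Fin s → Fin n → Carrier
      entry ω k j = y j * (query ω k i * query ω k j)

      baseProduct : Ω s n → Carrier
      baseProduct ω = product λ k → product λ j → 1# + entry ω k j

      y≤τ₁ : ∀ j → y j ≤ τ₁
      y≤τ₁ j = *-monoˡ-≤ 0≤z (≤-trans (x≤1+x² (b j))
        (+-monoʳ-≤ 1# (≤-trans (square≤sum-of-squares b j) (≤-reflexive ∥b∥²≈v))))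

      -y≤τ₁ : ∀ j → - y j ≤ τ₁
      -y≤τ₁ j = begin
        - (z * b j)                      ≈⟨ solve 2 (λ z b → :- (z :* b) := z :* :- b) refl z (b j) ⟩
        z * - b j                        ≤⟨ *-monoˡ-≤ 0≤z (x≤1+x² (- b j)) ⟩
        z * (1# + (- b j) * (- b j))     ≈⟨ solve 2 (λ z b → z :* (:1 :+ :- b :* :- b) := z :* (:1 :+ b :* b)) refl
                z (b j) ⟩
        z * (1# + b j * b j)             ≤⟨ *-monoˡ-≤ 0≤z (+-monoʳ-≤ 1# (≤-trans (square≤sum-of-squares b j) (≤-reflexive ∥b∥²≈v))) ⟩
        τ₁                               ∎

      firstOrderBound-1+a : ∀ {a} → a ≤ τ₁ → - a ≤ τ₁ → FirstOrderBound (1# + a) a τ₁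
      firstOrderBound-1+a {a} a≤τ₁ -a≤τ₁ = record
        { nonneg = ≤-trans (x≤y⇒0≤y-x (≤-trans -a≤τ₁ τ₁≤1)) (≤-reflexive (+-congˡ (-‿involutive a)))
        ; bound  = ≤-by-difference (²-nonneg τ₁) (solve 2 (λ a t → :1 :+ a :- t :* t :+ t :* t := :1 :+ a) refl
                a τ₁)
        ; -τ≤σ   = ≤-trans (x≤y⇒0≤y-x -a≤τ₁) (≤-reflexive (+-congˡ (-‿involutive a)))
        ; σ≤τ    = x≤y⇒0≤y-x a≤τ₁
        }

      entry-bound : ∀ ω k j → FirstOrderBound (1# + entry ω k j) (entry ω k j) τ₁
      entry-bound ω k j with sign-product (lookup (lookup ω k) i) (lookup (lookup ω k) j)
      ... | inj₁ eσ≈1 = firstOrderBound-1+a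
        (≤-trans (≤-reflexive e≈y) (y≤τ₁ j)) (≤-trans (≤-reflexive (-‿cong e≈y)) (-y≤τ₁ j))
        where
        e≈y : entry ω k j ≈ y j
        e≈y = trans (*-congˡ eσ≈1) (*-identityʳ (y j))
      ... | inj₂ eσ≈-1 = firstOrderBound-1+a
        (≤-trans (≤-reflexive e≈-y) (-y≤τ₁ j))
        (≤-trans (≤-reflexive (trans (-‿cong e≈-y) (-‿involutive (y j)))) (y≤τ₁ j))
        where
        e≈-y : entry ω k j ≈ - y j
        e≈-y = trans (*-congˡ eσ≈-1) (solve 1 (λ y → y :* :- :1 := :- y) refl (y j))

      baseProduct-bound : ∀ ω → FirstOrderBound (baseProduct ω) (sum λ k → sum (entry ω k)) τ
      baseProduct-bound ω = firstOrderBound-product 0≤nτ₁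
        (λ k → firstOrderBound-product 0≤τ₁ (entry-bound ω k) (2nτ₁≤1 k)) 2τ≤1
        where
        0≤nτ₁ : 0# ≤ n times τ₁
        0≤nτ₁ = ≤-trans (*-nonneg (fromℕ-nonneg n) 0≤τ₁) (≤-reflexive (sym (times≈* n τ₁)))
        t≤k-times-t : ∀ {k t} → Fin k → 0# ≤ t → t ≤ k times t
        t≤k-times-t {suc k} {t} _ 0≤t = ≤-by-difference
          (≤-trans (*-nonneg (fromℕ-nonneg k) 0≤t) (≤-reflexive (sym (times≈* k t)))) refl
        -- The index k witnesses that s is positive, so that one row's share of τ is at most τ.
        2nτ₁≤1 : Fin s → n times τ₁ + n times τ₁ ≤ 1#
        2nτ₁≤1 k = ≤-trans (+-mono-≤ (t≤k-times-t k 0≤nτ₁) (t≤k-times-t k 0≤nτ₁)) 2τ≤1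

      0≤baseProduct : ∀ ω → 0# ≤ baseProduct ω
      0≤baseProduct ω = FirstOrderBound.nonneg (baseProduct-bound ω)

      weight : Ω s n → Carrier
      weight ω = baseProduct ω ^ (m ℕ.+ m) * (1# - θ) ^ m

      0≤1-θ : 0# ≤ 1# - θ
      0≤1-θ = x≤y⇒0≤y-x θ≤1

      weight-nonneg : ∀ ω → 0# ≤ weight ω
      weight-nonneg ω = *-nonneg (^-nonneg (m ℕ.+ m) (0≤baseProduct ω)) (^-nonneg m 0≤1-θ)

      sum-entry : ∀ ω → (sum λ k → sum (entry ω k)) ≈ z * deviation b i ω
      sum-entry ω = sym (trans (*-distribˡ-sum z (λ k → sum (summand k))) (sum-cong-≋ λ k →
        trans (*-distribˡ-sum z (summand k)) (sum-cong-≋ λ j → sym (*-assoc z (b j) _))))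
        where
        summand : Fin s → Vector Carrier n
        summand k j = b j * (query ω k i * query ω k j)

      -- The pointwise half of Markov's inequality. W² ≥ 2W - 1 turns the first-order bound for W
      -- into W² ≥ 1 + θ - O(1/m²). Multiplying by 1 - θ leaves at least 1 - C/m², and Bernoulli's
      -- inequality limits the loss in the m-th power to C/m.
      weight-large : ∀ ω → x ≤ r * (deviation b i ω + deviation b i ω) → 1# - C * μ ≤ weight ω
      weight-large ω x≤rdev = begin
        1# - C * μ
          ≈⟨ solve 2 (λ c μ → :1 :- c :* μ := :1 :+ :1 :* (:- (c :* μ))) refl C μ ⟩
        1# + 1# * (- (C * μ))
          ≈⟨ +-congˡ (*-congʳ mμ≈1) ⟨
        1# + fromℕ m * μ * (- (C * μ))
          ≈⟨ +-congˡ (solve 3 (λ m μ c → m :* μ :* :- (c :* μ) := m :* (:- (c :* μ :* μ))) refl (fromℕ m) μ C) ⟩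
        1# + fromℕ m * (- (C * μ * μ))
          ≤⟨ bernoulli m 0≤1-Cμ² ⟩
        (1# - C * μ * μ) ^ m
          ≤⟨ ^-mono-≤ m 0≤1-Cμ² step-bound ⟩
        (W * W * (1# - θ)) ^ m
          ≈⟨ ^-distrib-* (W * W) (1# - θ) m ⟩
        (W * W) ^ m * (1# - θ) ^ m
          ≈⟨ *-congʳ (trans (^-distrib-* W W m) (sym (^-homo-* W m m))) ⟩
        W ^ (m ℕ.+ m) * (1# - θ) ^ m  ∎
        where
        W = baseProduct ω
        d = deviation b i ω
        0≤1-Cμ² : 0# ≤ 1# - C * μ * μ
        0≤1-Cμ² = x≤y⇒0≤y-x (≤-trans (*-monoʳ-≤ 0≤μ Cμ≤1) (≤-trans (≤-reflexive (*-identityˡ μ)) μ≤1))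
        W-bound : 1# + z * d - H * μ * (H * μ) ≤ W
        W-bound = ≤-trans (≤-reflexive (+-cong (+-congˡ (sym (sum-entry ω))) (-‿cong (sym (*-cong τ≈Hμ τ≈Hμ)))))
          (FirstOrderBound.bound (baseProduct-bound ω))
        W²-bound : 1# + θ - (H * H + H * H) * (μ * μ) ≤ W * W
        W²-bound = ≤-by-difference
          (+-nonneg (+-nonneg (*-nonneg (x≤y⇒0≤y-x x≤rdev) 0≤μ)
            (+-nonneg (x≤y⇒0≤y-x W-bound) (x≤y⇒0≤y-x W-bound))) (²-nonneg (W - 1#)))
          (solve 6 (λ x μ H r d W →
            :1 :+ x :* μ :- (H :* H :+ H :* H) :* (μ :* μ)
              :+ ((r :* (d :+ d) :- x) :* μ
                  :+ ((W :- (:1 :+ r :* μ :* d :- H :* μ :* (H :* μ))) :+ (W :- (:1 :+ r :* μ :* d :- H :* μ :* (H :* μ))))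
                  :+ (W :- :1) :* (W :- :1))
            := W :* W) refl x μ H r d W)
        step-bound : 1# - C * μ * μ ≤ W * W * (1# - θ)
        step-bound = begin
          1# - C * μ * μ
            ≤⟨ ≤-by-difference (*-nonneg (*-nonneg (+-nonneg (²-nonneg H) (²-nonneg H)) (²-nonneg μ)) (*-nonneg 0≤x 0≤μ))
                 (solve 3 (λ x μ h → :1 :- (x :* x :+ h) :* μ :* μ :+ h :* (μ :* μ) :* (x :* μ)
                   := (:1 :+ x :* μ :- h :* (μ :* μ)) :* (:1 :- x :* μ)) refl x μ (H * H + H * H)) ⟩
          (1# + θ - (H * H + H * H) * (μ * μ)) * (1# - θ)
            ≤⟨ *-monoʳ-≤ 0≤1-θ W²-bound ⟩
          W * W * (1# - θ)  ∎

      u : Vector Carrier n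
      u j = y j * y j

      -- V^m bounds the mean of `baseProduct ω ^ N` and stands for exp B; accordingly V itself is
      -- compared with 1/(1 - B/m).
      K V : Carrier
      K = product λ j → 1# + u j
      V = (K ^ (m ℕ.+ m)) ^ s

      reciprocalBound-K : ReciprocalBound K (sum u)
      reciprocalBound-K = reciprocalBound-product λ j → reciprocalBound-1+u (²-nonneg (y j))

      reciprocalBound-V : ReciprocalBound V (s times ((m ℕ.+ m) times sum u))
      reciprocalBound-V = reciprocalBound-^ s (reciprocalBound-^ (m ℕ.+ m) reciprocalBound-K)

      sum-u : sum u ≈ z * z * v
      sum-u = trans (sum-cong-≋ λ j → solve 2 (λ z b → z :* b :* (z :* b) := z :* z :* (b :* b)) refl z (b j))
        (trans (sym (*-distribˡ-sum (z * z) (λ j → b j * b j))) (*-congˡ ∥b∥²≈v))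

      exponent≈Bμ : s times ((m ℕ.+ m) times sum u) ≈ B * μ
      exponent≈Bμ = begin-equality
        s times ((m ℕ.+ m) times sum u)
          ≈⟨ trans (times≈* s _) (*-congˡ (trans (times≈* (m ℕ.+ m) _) (*-cong (fromℕ-+ m m) sum-u))) ⟩
        fromℕ s * ((fromℕ m + fromℕ m) * (r * μ * (r * μ) * v))
          ≈⟨ solve 5 (λ s m r μ v → s :* ((m :+ m) :* (r :* μ :* (r :* μ) :* v))
               := :2 :* (s :* (r :* r :* v)) :* μ :* (m :* μ)) refl (fromℕ s) (fromℕ m) r μ v ⟩
        B * μ * (fromℕ m * μ)
          ≈⟨ trans (*-congˡ mμ≈1) (*-identityʳ _) ⟩
        B * μ  ∎

      V[1-Bμ]≤1 : V * (1# - B * μ) ≤ 1#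
      V[1-Bμ]≤1 = ≤-trans (≤-reflexive (*-congˡ (+-congˡ (-‿cong (sym exponent≈Bμ)))))
        (ReciprocalBound.bound reciprocalBound-V)

      0≤V : 0# ≤ V
      0≤V = ReciprocalBound.nonneg reciprocalBound-V

      total : Carrier
      total = (fromℕ 2 ^ n) ^ s

      0≤total : 0# ≤ total
      0≤total = ^-nonneg s (^-nonneg n (fromℕ-nonneg 2))

      N M : ℕ
      N = m ℕ.+ m
      M = (m ℕ.+ m) ℕ.* m

      sumOver-baseProduct-^ : sumOver (outcomes s n) (λ ω → baseProduct ω ^ N) ≈ product (λ j → signSum N (y j)) ^ s
      sumOver-baseProduct-^ = begin-equality
        sumOver (outcomes s n) (λ ω → baseProduct ω ^ N)
          ≈⟨ sumOver-cong (outcomes s n) (λ ω → sym (trans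
               (product-cong λ k → product-^ N (λ j → 1# + entry ω k j))
               (product-^ N (λ k → product (λ j → 1# + entry ω k j))))) ⟩
        sumOver (outcomes s n) (λ ω → product (λ k → row (lookup ω k)))
          ≈⟨ sumOver-vectors-product (vectorsOver signs n) s row ⟩
        sumOver (vectorsOver signs n) row ^ s
          ≈⟨ ^-congˡ s (sumOver-rowProduct N y i (trans (*-congˡ bᵢ≈0) (zeroʳ z))) ⟩
        product (λ j → signSum N (y j)) ^ s  ∎
        where
        row : Vec Sign n → Carrier
        row σs = rowProduct N y (lookup σs i) σs

      sumOver-baseProduct-^-≤ : sumOver (outcomes s n) (λ ω → baseProduct ω ^ N) ≤ total * V ^ m
      sumOver-baseProduct-^-≤ = begin
        sumOver (outcomes s n) (λ ω → baseProduct ω ^ N)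
          ≈⟨ sumOver-baseProduct-^ ⟩
        product (λ j → signSum N (y j)) ^ s
          ≤⟨ ^-mono-≤ s (product-nonneg λ j → signSum-nonneg N (y j))
               (product-mono-≤ (λ j → signSum-nonneg N (y j)) (λ j → signSum≤ m (y j))) ⟩
        product (λ j → fromℕ 2 * (1# + u j) ^ M) ^ s
          ≈⟨ ^-congˡ s (trans (product-*ˡ (fromℕ 2) (λ j → (1# + u j) ^ M)) (*-congˡ (product-^ M (λ j → 1# + u j)))) ⟩
        (fromℕ 2 ^ n * K ^ M) ^ s
          ≈⟨ ^-distrib-* _ _ s ⟩
        total * (K ^ M) ^ s
          ≈⟨ *-congˡ (begin-equality
               (K ^ M) ^ s           ≈⟨ ^-congˡ s (^-assocʳ K N m) ⟨
               ((K ^ N) ^ m) ^ s     ≈⟨ ^-assocʳ (K ^ N) m s ⟩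
               (K ^ N) ^ (m ℕ.* s)   ≡⟨ ≡.cong ((K ^ N) ^_) (ℕ.*-comm m s) ⟩
               (K ^ N) ^ (s ℕ.* m)   ≈⟨ ^-assocʳ (K ^ N) s m ⟨
               V ^ m                 ∎) ⟩
        total * V ^ m  ∎

      exp[L]*[1-Lμ]^m≤1 : ∀ k → exp[ k ] L * (1# - L * μ) ^ m ≤ 1#
      exp[L]*[1-Lμ]^m≤1 k = begin
        exp[ k ] L * (1# - L * μ) ^ m
          ≈⟨ *-congʳ (exp-cong k (sym (trans
               (solve 3 (λ m L μ → m :* (L :* μ) := L :* (m :* μ)) refl (fromℕ m) L μ)
               (trans (*-congˡ mμ≈1) (*-identityʳ L))))) ⟩
        exp[ k ] (fromℕ m * (L * μ)) * (1# - L * μ) ^ m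
          ≤⟨ exp[jy]*[1-y]^j≤1 k m (*-nonneg 0≤L 0≤μ) Lμ≤1 ⟩
        1#  ∎

      -- Splits the substitute for exp(-(L + B)): the first factor will cancel V^m, the second the
      -- partial sum of exp L.
      [1-θ]^m≤ : (1# - θ) ^ m ≤ (1# - B * μ) ^ m * (1# - L * μ) ^ m
      [1-θ]^m≤ = ≤-trans
        (^-mono-≤ m 0≤1-θ (≤-by-difference (*-nonneg (*-nonneg 0≤B 0≤L) (²-nonneg μ))
          (solve 3 (λ L B μ → :1 :- (L :+ B) :* μ :+ B :* L :* (μ :* μ) := (:1 :- B :* μ) :* (:1 :- L :* μ)) refl
                  L B μ)))
        (≤-reflexive (^-distrib-* _ _ m))

      -- The averaged half of Markov's inequality: the mean weight is at most exp(-L), stated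
      -- without a division.
      sumOver-weight : ∀ k → sumOver (outcomes s n) weight * exp[ k ] L ≤ total
      sumOver-weight k = begin
        sumOver (outcomes s n) weight * E
          ≈⟨ *-congʳ (sumOver-*ʳ (outcomes s n) (λ ω → baseProduct ω ^ N) ((1# - θ) ^ m)) ⟩
        sumOver (outcomes s n) (λ ω → baseProduct ω ^ N) * (1# - θ) ^ m * E
          ≤⟨ *-monoʳ-≤ 0≤E (*-monoʳ-≤ (^-nonneg m 0≤1-θ) sumOver-baseProduct-^-≤) ⟩
        total * V ^ m * (1# - θ) ^ m * E
          ≤⟨ *-monoʳ-≤ 0≤E (*-monoˡ-≤ (*-nonneg 0≤total (^-nonneg m 0≤V)) [1-θ]^m≤) ⟩
        total * V ^ m * ((1# - B * μ) ^ m * (1# - L * μ) ^ m) * E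
          ≈⟨ solve 5 (λ t v p q e → t :* v :* (p :* q) :* e := t :* ((v :* p) :* (e :* q))) refl
               total (V ^ m) ((1# - B * μ) ^ m) ((1# - L * μ) ^ m) E ⟩
        total * (V ^ m * (1# - B * μ) ^ m * (E * (1# - L * μ) ^ m))
          ≤⟨ *-monoˡ-≤ 0≤total (*-mono-≤
               (*-nonneg (^-nonneg m 0≤V) (^-nonneg m (x≤y⇒0≤y-x Bμ≤1)))
               (*-nonneg 0≤E (^-nonneg m (x≤y⇒0≤y-x Lμ≤1)))
               [V[1-Bμ]]^m≤1 (exp[L]*[1-Lμ]^m≤1 k)) ⟩
        total * (1# * 1#)
          ≈⟨ solve 1 (λ t → t :* (:1 :* :1) := t) refl total ⟩
        total  ∎
        where
        E = exp[ k ] L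
        0≤E = exp-nonneg k 0≤L
        [V[1-Bμ]]^m≤1 : V ^ m * (1# - B * μ) ^ m ≤ 1#
        [V[1-Bμ]]^m≤1 = begin
          V ^ m * (1# - B * μ) ^ m    ≈⟨ ^-distrib-* V (1# - B * μ) m ⟨
          (V * (1# - B * μ)) ^ m      ≤⟨ ^-mono-≤ m (*-nonneg 0≤V (x≤y⇒0≤y-x Bμ≤1)) V[1-Bμ]≤1 ⟩
          1# ^ m                      ≈⟨ 1^n≈1 m ⟩
          1#                          ∎

-- Union of the two tails and passage to probabilities.

module DiagonalEstimate {c ℓ₁ ℓ₂} (ℝ : RealNumbers c ℓ₁ ℓ₂) where
  open RealNumbers ℝ hiding (zero)
  open OrderedField ℝ
  open ExponentialSeries ℝ
  open ProductEstimates ℝ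
  open DiagonalEstimation ℝ
  open RademacherSums ℝ
  open ChernoffBound ℝ
  open ≤-Reasoning
  open SumProperties (CommutativeRing.semiring commutativeRing) using (sum-cong-≋)

  x+x≤y+y⇒x≤y : ∀ {x y} → x + x ≤ y + y → x ≤ y
  x+x≤y+y⇒x≤y {x} {y} 2x≤2y = ≤-by-difference
    (0≤x+x⇒0≤x (≤-trans (x≤y⇒0≤y-x 2x≤2y)
      (≤-reflexive (solve 2 (λ x y → y :+ y :- (x :+ x) := (y :- x) :+ (y :- x)) refl x y))))
    (solve 2 (λ x y → x :+ (y :- x) := y) refl x y)

  sum-neg : ∀ {n} (f : Vector Carrier n) → sum (λ j → - f j) ≈ - sum f
  sum-neg {zero}  f = sym -0#≈0#
  sum-neg {suc n} f = trans (+-congˡ (sum-neg (f ∘ suc)))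
    (solve 2 (λ a b → :- a :+ :- b := :- (a :+ b)) refl (f zero) (sum (f ∘ suc)))

  deviation-neg : ∀ {n s} (b : Vector Carrier n) i (ω : Ω s n) → deviation (λ j → - b j) i ω ≈ - deviation b i ω
  deviation-neg {n} {s} b i ω = trans
    (sum-cong-≋ λ k → trans (sum-cong-≋ λ j → sym (-‿distribˡ-* (b j) (query ω k i * query ω k j))) (sum-neg (entry k)))
    (sum-neg λ k → sum (entry k))
    where
    entry : Fin s → Vector Carrier n
    entry k j = b j * (query ω k i * query ω k j)

  isRight : ∀ {p q} {P : Set p} {Q : Set q} → P ⊎ Q → Bool
  isRight = [ const false , const true ]′

  -- Lets the number of terms grow: if δt < x, then 2t/x < 2/δ = exp l, so some partial sum exceeds
  -- 2t/x, against the bound.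
  ≤-by-exp-limit : ∀ {x t δ l} (0<δ : 0# < δ) → 0# < t → IsLn (fromℕ 2 / δ [ pos⇒#0 0<δ ]) l →
    (∀ k → x * exp[ k ] l ≤ fromℕ 2 * t) → x ≤ δ * t
  ≤-by-exp-limit {x} {t} {δ} {l} 0<δ 0<t isLn bound δt<x = bound k (begin-strict
      fromℕ 2 * t                   ≈⟨ *-identityʳ _ ⟨
      fromℕ 2 * t * 1#              ≈⟨ *-congˡ xx⁻¹≈1 ⟨
      fromℕ 2 * t * (x * x⁻¹)       ≈⟨ solve 4 (λ u t x y → u :* t :* (x :* y) := x :* (u :* y :* t)) refl
              (fromℕ 2) t x x⁻¹ ⟩
      x * (fromℕ 2 * x⁻¹ * t)       <⟨ *-monoˡ-< 0<x (proj₂ eventually k ℕ.≤-refl) ⟩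
      x * expSum l k                ≈⟨ *-congˡ (expSum≈exp k l) ⟩
      x * exp[ k ] l                ∎)
    where
    δ⁻¹ = δ ⁻¹[ pos⇒#0 0<δ ]
    0<x : 0# < x
    0<x = <-trans (*-pos 0<δ 0<t) δt<x
    x⁻¹ = x ⁻¹[ pos⇒#0 0<x ]
    xx⁻¹≈1 : x * x⁻¹ ≈ 1#
    xx⁻¹≈1 = *-inverseʳ (pos⇒#0 0<x)
    2t/x<2/δ : fromℕ 2 * x⁻¹ * t < fromℕ 2 * δ⁻¹
    2t/x<2/δ = begin-strict
      fromℕ 2 * x⁻¹ * t                   ≈⟨ *-identityʳ _ ⟨
      fromℕ 2 * x⁻¹ * t * 1#              ≈⟨ *-congˡ (*-inverseʳ (pos⇒#0 0<δ)) ⟨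
      fromℕ 2 * x⁻¹ * t * (δ * δ⁻¹)       ≈⟨ solve 5 (λ u y t d e → u :* y :* t :* (d :* e) := u :* y :* e :* (d :* t)) refl
              (fromℕ 2) x⁻¹ t δ δ⁻¹ ⟩
      fromℕ 2 * x⁻¹ * δ⁻¹ * (δ * t)       <⟨ *-monoˡ-< (*-pos (*-pos (fromℕ-pos 2) (⁻¹-pos 0<x)) (⁻¹-pos 0<δ)) δt<x ⟩
      fromℕ 2 * x⁻¹ * δ⁻¹ * x             ≈⟨ solve 4 (λ u y e x → u :* y :* e :* x := u :* e :* (x :* y)) refl
              (fromℕ 2) x⁻¹ δ⁻¹ x ⟩
      fromℕ 2 * δ⁻¹ * (x * x⁻¹)           ≈⟨ trans (*-congˡ xx⁻¹≈1) (*-identityʳ _) ⟩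
      fromℕ 2 * δ⁻¹                       ∎
    eventually : ∃ λ N → ∀ k → N ℕ.≤ k → fromℕ 2 * x⁻¹ * t < expSum l k
    eventually = ⟶-eventually-> isLn 2t/x<2/δ
    k = proj₁ eventually

  module Proof {n} (A : Matrix n) (i : Fin n) (Aᵢᵢ#0 : A i i # 0#)
    (ε̄ δ : Carrier) (0<ε̄ : 0# < ε̄) (0<δ : 0# < δ) (δ<1 : δ < 1#)
    (s : ℕ) .{{_ : NonZero s}}
    (L : Carrier) (isLn : IsLn (fromℕ 2 / δ [ pos⇒#0 0<δ ]) L)
    (s-large : fromℕ 2 * ((∥ A i ∥₂² - A i i ²) / A i i ² [ ²#0 Aᵢᵢ#0 ])
        * (L / ε̄ ² [ ²#0 (pos⇒#0 0<ε̄) ]) < fromℕ s)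
    where

    a η v Q sℝ ρ r δ⁻¹ : Carrier
    a = A i i
    η = ε̄ * ∣ a ∣
    v = ∥ A i ∥₂² - a ²
    Q = fromℕ 2 * (v / a ² [ ²#0 Aᵢᵢ#0 ]) * (L / ε̄ ² [ ²#0 (pos⇒#0 0<ε̄) ])
    sℝ = fromℕ s

    0<s : 0# < sℝ
    0<s = fromℕ-pos s

    0<η : 0# < η
    0<η = *-pos 0<ε̄ (0<∣x∣ Aᵢᵢ#0)

    0<sη : 0# < sℝ * η
    0<sη = *-pos 0<s 0<η

    ρ = (sℝ * η) ⁻¹[ pos⇒#0 0<sη ]
    r = L * ρ
    δ⁻¹ = δ ⁻¹[ pos⇒#0 0<δ ]

    sηρ≈1 : sℝ * η * ρ ≈ 1#
    sηρ≈1 = *-inverseʳ (pos⇒#0 0<sη)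

    0<δ⁻¹ : 0# < δ⁻¹
    0<δ⁻¹ = ⁻¹-pos 0<δ

    1<2/δ : 1# < fromℕ 2 * δ⁻¹
    1<2/δ = begin-strict
      1#               ≈⟨ trans (*-comm δ⁻¹ δ) (*-inverseʳ (pos⇒#0 0<δ)) ⟨
      δ⁻¹ * δ          <⟨ *-monoˡ-< 0<δ⁻¹ δ<1 ⟩
      δ⁻¹ * 1#         ≤⟨ ≤-by-difference (<⇒≤ 0<δ⁻¹) (solve 1 (λ d → d :* :1 :+ d := :2 :* d) refl δ⁻¹) ⟩
      fromℕ 2 * δ⁻¹    ∎

    0≤L : 0# ≤ L
    0≤L = IsExp⇒0≤ isLn 1<2/δ

    0≤r : 0# ≤ r
    0≤r = *-nonneg 0≤L (<⇒≤ (⁻¹-pos 0<sη))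

    b -b : Vector Carrier n
    b = offDiagonal i (A i)
    -b j = - b j

    ∥b∥²≈v : ∥ b ∥₂² ≈ v
    ∥b∥²≈v = sum-offDiagonal-² i (A i)

    0≤v : 0# ≤ v
    0≤v = ≤-trans (∥∥₂²-nonneg b) (≤-reflexive ∥b∥²≈v)

    -- The lower tail is the upper tail of -b, whose norm is the same. As `v` is a parameter, not
    -- computed from the vector, the constants `x`, `C` and `negligible` of both instances agree
    -- definitionally.
    module Upper = UpperTail s i b (offDiagonal-i i (A i)) v ∥b∥²≈v 0≤v L r 0≤L 0≤r
    module Lower = UpperTail s i -b (trans (-‿cong (offDiagonal-i i (A i))) -0#≈0#) v
      (trans (sum-cong-≋ λ j → solve 1 (λ x → :- x :* :- x := x :* x) refl (b j)) ∥b∥²≈v) 0≤v L r 0≤L 0≤r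

    -- The slack in the hypothesis on s separates the two thresholds, so that
    -- one can decide which side of them 2 · deviation lies on.
    lower-threshold upper-threshold : Carrier
    lower-threshold = η * (sℝ + Q)
    upper-threshold = η * (sℝ + sℝ)

    thresholds : lower-threshold < upper-threshold
    thresholds = *-monoˡ-< 0<η (+-monoʳ-< sℝ s-large)

    -- Clears the denominators in the hypothesis on s, since η² = ε̄² Aᵢᵢ².
    Qη²≈2vL : Q * (η * η) ≈ fromℕ 2 * v * L
    Qη²≈2vL = begin-equality
      fromℕ 2 * (v * a⁻²) * (L * ε⁻²) * (ε̄ * ∣ a ∣ * (ε̄ * ∣ a ∣))
        ≈⟨ solve 7 (λ t v w L e ε a → t :* (v :* w) :* (L :* e) :* (ε :* a :* (ε :* a))
             := t :* v :* L :* (a :* a :* w) :* (ε :* ε :* e)) refl (fromℕ 2) v a⁻² L ε⁻² ε̄ ∣ a ∣ ⟩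
      fromℕ 2 * v * L * (∣ a ∣ * ∣ a ∣ * a⁻²) * (ε̄ * ε̄ * ε⁻²)
        ≈⟨ *-cong (*-congˡ (trans (*-congʳ (∣x∣²≈x² Aᵢᵢ#0)) (*-inverseʳ (²#0 Aᵢᵢ#0)))) (*-inverseʳ (²#0 (pos⇒#0 0<ε̄))) ⟩
      fromℕ 2 * v * L * 1# * 1#
        ≈⟨ trans (*-identityʳ _) (*-identityʳ _) ⟩
      fromℕ 2 * v * L  ∎
      where
      a⁻² = (a ²) ⁻¹[ ²#0 Aᵢᵢ#0 ]
      ε⁻² = (ε̄ ²) ⁻¹[ ²#0 (pos⇒#0 0<ε̄) ]

    -- The reason for the choice of r: rηs = L and rηQ = 2sr²v = B. Exceeding the lower threshold
    -- thus gives the premise of `weight-large`.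
    r*threshold≈L+B : r * lower-threshold ≈ Upper.x
    r*threshold≈L+B = begin-equality
      L * ρ * (η * (sℝ + Q))
        -- The trailing 1 is to be replaced by sηρ, which supplies the second η for Qη² and the
        -- second ρ for r².
        ≈⟨ solve 5 (λ L ρ η s Q → L :* ρ :* (η :* (s :+ Q)) := L :* (s :* η :* ρ) :+ L :* ρ :* η :* Q :* :1) refl
                L ρ η sℝ Q ⟩
      L * (sℝ * η * ρ) + L * ρ * η * Q * 1#
        ≈⟨ +-cong (*-congˡ sηρ≈1) (*-congˡ (sym sηρ≈1)) ⟩
      L * 1# + L * ρ * η * Q * (sℝ * η * ρ)
        ≈⟨ solve 5 (λ L ρ η s Q → L :* :1 :+ L :* ρ :* η :* Q :* (s :* η :* ρ) := L :+ L :* s :* (ρ :* ρ) :* (Q :* (η :* η))) refl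
                L ρ η sℝ Q ⟩
      L + L * sℝ * (ρ * ρ) * (Q * (η * η))
        ≈⟨ +-congˡ (*-congˡ Qη²≈2vL) ⟩
      L + L * sℝ * (ρ * ρ) * (fromℕ 2 * v * L)
        ≈⟨ solve 5 (λ L s ρ t v → L :+ L :* s :* (ρ :* ρ) :* (t :* v :* L)
             := L :+ t :* (s :* (L :* ρ :* (L :* ρ) :* v))) refl L sℝ ρ (fromℕ 2) v ⟩
      L + fromℕ 2 * (sℝ * (r * r * v))  ∎

    dev : Ω s n → Carrier
    dev = deviation b i

    split⁺ : ∀ ω → lower-threshold < dev ω + dev ω ⊎ dev ω + dev ω < upper-threshold
    split⁺ ω = <-cotrans thresholds (dev ω + dev ω)

    split⁻ : ∀ ω → lower-threshold < - dev ω + - dev ω ⊎ - dev ω + - dev ω < upper-threshold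
    split⁻ ω = <-cotrans thresholds (- dev ω + - dev ω)

    -- Between the thresholds the value depends on which alternative `<-cotrans` returns, and either
    -- is safe: accepted outcomes lie below the upper threshold on both sides, rejected ones exceed
    -- the lower threshold on one side and so have a large weight.
    D : Ω s n → Bool
    D ω = isRight (split⁺ ω) ∧ isRight (split⁻ ω)

    D-sound : ∀ ω → T (D ω) → ∣ rademacherEstimator A ω i - a ∣ ≤ η
    D-sound ω Dω = close (split⁺ ω) (split⁻ ω) Dω
      where
      R-a = rademacherEstimator A ω i - a
      s[R-a]≈dev : sℝ * R-a ≈ dev ω
      s[R-a]≈dev = estimator-deviation A i ω
      below : ∀ {x y} → sℝ * y ≈ x → x + x < upper-threshold → y ≤ η
      below {x} {y} sy≈x 2x<U = *-cancelˡ-≤ 0<s (≤-trans (≤-reflexive sy≈x) (x+x≤y+y⇒x≤y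
        (≤-trans (<⇒≤ 2x<U) (≤-reflexive (solve 2 (λ η s → η :* (s :+ s) := s :* η :+ s :* η) refl η sℝ)))))
      close : (p : lower-threshold < dev ω + dev ω ⊎ dev ω + dev ω < upper-threshold)
        (q : lower-threshold < - dev ω + - dev ω ⊎ - dev ω + - dev ω < upper-threshold) →
        T (isRight p ∧ isRight q) → ∣ R-a ∣ ≤ η
      close (inj₂ dev-small) (inj₂ -dev-small) _ = ∣x∣≤ (below s[R-a]≈dev dev-small)
        (below (trans (solve 2 (λ s x → s :* :- x := :- (s :* x)) refl sℝ R-a) (-‿cong s[R-a]≈dev)) -dev-small)

    far : Ω s n → Carrier
    far ω = 1# - indicator (D ω)

    far-nonneg : ∀ ω → 0# ≤ far ω
    far-nonneg ω = nonneg (D ω)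
      where
      nonneg : ∀ d → 0# ≤ 1# - indicator d
      nonneg true  = ≤-reflexive (sym (-‿inverseʳ 1#))
      nonneg false = ≤-trans 0≤1 (≤-reflexive (sym (x-0≈x 1#)))

    total F : Carrier
    total = (fromℕ 2 ^ n) ^ s
    F = sumOver (outcomes s n) far

    0≤F : 0# ≤ F
    0≤F = sumOver-nonneg (outcomes s n) far-nonneg

    threshold⇒x≤ : ∀ {d d′} → d ≈ d′ → lower-threshold < d + d → Upper.x ≤ r * (d′ + d′)
    threshold⇒x≤ d≈d′ U<2d = ≤-trans (≤-reflexive (sym r*threshold≈L+B))
      (*-monoˡ-≤ 0≤r (≤-trans (<⇒≤ U<2d) (≤-reflexive (+-cong d≈d′ d≈d′))))

    -- The union bound: a rejected outcome has a large weight in one of the two tails. Each tail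
    -- contributes one `total`, which is the origin of the 2 in ln(2/δ).
    F*exp≤ : ∀ k m μ .{{_ : NonZero m}} → 0# < μ → fromℕ m * μ ≈ 1# → Upper.negligible * μ ≤ 1# →
      F * exp[ k ] L ≤ fromℕ 2 * total + F * exp[ k ] L * Upper.C * μ
    F*exp≤ k m μ 0<μ mμ≈1 small = begin
      F * E
        ≈⟨ solve 4 (λ F E C μ → F :* E := F :* (:1 :- C :* μ) :* E :+ F :* E :* C :* μ) refl F E Upper.C μ ⟩
      F * (1# - Upper.C * μ) * E + F * E * Upper.C * μ
        ≤⟨ +-monoˡ-≤ _ (begin
             F * (1# - Upper.C * μ) * E
               ≈⟨ *-congʳ (sumOver-*ʳ (outcomes s n) far _) ⟨
             sumOver (outcomes s n) (λ ω → far ω * (1# - Upper.C * μ)) * E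
               ≤⟨ *-monoʳ-≤ (exp-nonneg k 0≤L) (sumOver-mono-≤ (outcomes s n) pointwise) ⟩
             sumOver (outcomes s n) (λ ω → U.weight ω + W.weight ω) * E
               ≈⟨ *-congʳ (sumOver-+ (outcomes s n) U.weight W.weight) ⟩
             (sumOver (outcomes s n) U.weight + sumOver (outcomes s n) W.weight) * E
               ≈⟨ distribʳ E _ _ ⟩
             sumOver (outcomes s n) U.weight * E + sumOver (outcomes s n) W.weight * E
               ≤⟨ +-mono-≤ (U.sumOver-weight k) (W.sumOver-weight k) ⟩
             total + total
               ≈⟨ solve 1 (λ t → t :+ t := :2 :* t) refl total ⟩
             fromℕ 2 * total  ∎) ⟩
      fromℕ 2 * total + F * E * Upper.C * μ  ∎
      where
      module U = Upper.Step m μ 0<μ mμ≈1 small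
      module W = Lower.Step m μ 0<μ mμ≈1 small
      E = exp[ k ] L
      pointwise : ∀ ω → far ω * (1# - Upper.C * μ) ≤ U.weight ω + W.weight ω
      pointwise ω = cases (split⁺ ω) (split⁻ ω)
        where
        κ = 1# - Upper.C * μ
        1-0 : (1# - 0#) * κ ≈ κ
        1-0 = solve 1 (λ c → (:1 :- :0) :* c := c) refl κ
        cases : (p : lower-threshold < dev ω + dev ω ⊎ dev ω + dev ω < upper-threshold)
          (q : lower-threshold < - dev ω + - dev ω ⊎ - dev ω + - dev ω < upper-threshold) →
          (1# - indicator (isRight p ∧ isRight q)) * κ ≤ U.weight ω + W.weight ω
        cases (inj₁ dev-large) _ = ≤-trans (≤-reflexive 1-0)
          (≤-trans (U.weight-large ω (threshold⇒x≤ refl dev-large))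
            (≤-by-difference (W.weight-nonneg ω) refl))
        cases (inj₂ _) (inj₁ -dev-large) = ≤-trans (≤-reflexive 1-0)
          (≤-trans (W.weight-large ω (threshold⇒x≤ (sym (deviation-neg b i ω)) -dev-large))
            (≤-by-difference (U.weight-nonneg ω) (+-comm _ _)))
        cases (inj₂ _) (inj₂ _) = ≤-trans (≤-reflexive (trans (*-congʳ (-‿inverseʳ 1#)) (zeroˡ κ)))
          (+-nonneg (U.weight-nonneg ω) (W.weight-nonneg ω))

    F*exp≤2total : ∀ k → F * exp[ k ] L ≤ fromℕ 2 * total
    F*exp≤2total k = ≤-by-vanishing Upper.0≤negligible
      (*-nonneg (*-nonneg 0≤F (exp-nonneg k 0≤L)) Upper.0≤C) (F*exp≤ k)

    count : Carrier
    count = fromℕ (length (filterᵇ D (outcomes s n)))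

    F+count≈total : F + count ≈ total
    F+count≈total = begin-equality
      F + count
        ≈⟨ +-congˡ (count≈sumOver D (outcomes s n)) ⟩
      F + sumOver (outcomes s n) (indicator ∘ D)
        ≈⟨ sumOver-+ (outcomes s n) far (indicator ∘ D) ⟨
      sumOver (outcomes s n) (λ ω → far ω + indicator (D ω))
        ≈⟨ sumOver-cong (outcomes s n) (λ ω → solve 1 (λ d → :1 :- d :+ d := :1) refl (indicator (D ω))) ⟩
      sumOver (outcomes s n) (const 1#)
        ≈⟨ sumOver-outcomes-1 s n ⟩
      total  ∎

    0<total : 0# < total
    0<total = <-respʳ-≈ (fromℕ-2^[s*n] s n) (fromℕ-pos (2 ℕ.^ (s ℕ.* n)) {{ℕ.m^n≢0 2 (s ℕ.* n)}})

    Pr*total≈count : Pr D * total ≈ count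
    Pr*total≈count = begin-equality
      count * t⁻¹ * total    ≈⟨ *-congˡ (fromℕ-2^[s*n] s n) ⟨
      count * t⁻¹ * t        ≈⟨ solve 3 (λ c t t⁻¹ → c :* t⁻¹ :* t := c :* (t :* t⁻¹)) refl count t t⁻¹ ⟩
      count * (t * t⁻¹)      ≈⟨ *-congˡ (*-inverseʳ t#0) ⟩
      count * 1#             ≈⟨ *-identityʳ count ⟩
      count                  ∎
      where
      t = fromℕ (2 ℕ.^ (s ℕ.* n))
      t#0 = fromℕ#0 (2 ℕ.^ (s ℕ.* n)) {{ℕ.m^n≢0 2 (s ℕ.* n)}}
      t⁻¹ = t ⁻¹[ t#0 ]

    F≤δ*total : F ≤ δ * total
    F≤δ*total = ≤-by-exp-limit 0<δ 0<total isLn F*exp≤2total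

    Pr-large : 1# - δ ≤ Pr D
    Pr-large = *-cancelˡ-≤ 0<total (begin
      total * (1# - δ)        ≈⟨ solve 2 (λ t d → t :* (:1 :- d) := t :- d :* t) refl total δ ⟩
      total - δ * total       ≤⟨ +-monoʳ-≤ total (neg-≤ F≤δ*total) ⟩
      total - F               ≈⟨ +-congʳ F+count≈total ⟨
      F + count - F           ≈⟨ solve 2 (λ F c → F :+ c :- F := c) refl F count ⟩
      count                   ≈⟨ Pr*total≈count ⟨
      Pr D * total            ≈⟨ *-comm (Pr D) total ⟩
      total * Pr D            ∎)

    estimate : Pr[ (λ (ω : Ω s n) → ∣ rademacherEstimator A ω i - A i i ∣ ≤ ε̄ * ∣ A i i ∣) ]≥ 1# - δ
    estimate = D , D-sound , Pr-large

mainTheorem6 : ∀ {c ℓ₁ ℓ₂} (ℝ : RealNumbers c ℓ₁ ℓ₂) →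
    let open RealNumbers ℝ
        open DiagonalEstimation ℝ
    in
    ∀ {n} (A : Matrix n) (i : Fin n) (Aᵢᵢ#0 : A i i # 0#)
      (ε̄ δ : Carrier) (0<ε̄ : 0# < ε̄) (0<δ : 0# < δ) (δ<1 : δ < 1#)
      (s : ℕ) .{{_ : NonZero s}}
      (ln[2/δ] : Carrier) → IsLn (fromℕ 2 / δ [ pos⇒#0 0<δ ]) ln[2/δ] →
      fromℕ 2 * ((∥ A i ∥₂² - A i i ²) / A i i ² [ ²#0 Aᵢᵢ#0 ])
        * (ln[2/δ] / ε̄ ² [ ²#0 (pos⇒#0 0<ε̄) ]) < fromℕ s →
      Pr[ (λ (ω : Ω s n) → ∣ rademacherEstimator A ω i - A i i ∣ ≤ ε̄ * ∣ A i i ∣) ]≥ 1# - δ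
mainTheorem6 ℝ A i Aᵢᵢ#0 ε̄ δ 0<ε̄ 0<δ δ<1 s ln[2/δ] isLn s-large =
  DiagonalEstimate.Proof.estimate ℝ A i Aᵢᵢ#0 ε̄ δ 0<ε̄ 0<δ δ<1 s ln[2/δ] isLn s-large
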